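{- Let $\mathcal{H}$ be a hypergraph on $n$ vertices with maximum degree at most $\Delta$ and hyperedge-size at most $b+1$, and let $v\in V(\mathcal{H})$. Let $(\mathcal{T},r)$ with labeling $\pi:V(\mathcal{T})\to V(\mathcal{H})$ be the Weitz-hypertree of $\mathcal{H}$ at $v$ (as defined in the context). Then, as rational functions, \[ \frac{Z^{\mathrm{in}}_{v}(\mathcal{H};\bm\lambda)}{Z^{\mathrm{out}}_{v}(\mathcal{H};\bm\lambda)}=\frac{Z^{\mathrm{in}}_{r}(\mathcal{T};\bm\lambda')}{Z_{r}^{\mathrm{out}}(\mathcal{T};\bm\lambda')}, \] where $\bm\lambda'_u=\bm\lambda_{\pi(u)}$ for every $u\in V(\mathcal{T})$.
   Context: A hypergraph $\mathcal{H}=(V,E)$ has finite vertex set $V$ and a set $E$ of nonempty subsets of $V$. Independent sets are $U\subseteq V$ containing no hyperedge; $Z(\mathcal{H};\bm\lambda)=\sum_{U\text{ indep.}}\prod_{u\in U}\bm\lambda_u$ with variables $\bm\lambda\in\mathbb{C}^V$. For $v\in V$, $Z_v^{\mathrm{in}}$ is the sum over independent $U$ containing $v$ and $Z_v^{\mathrm{out}}=Z-Z_v^{\mathrm{in}}$. For a subhypergraph $\mathcal{H}'$ on vertex set $V'\subseteq V$, $Z(\mathcal{H}';\bm\lambda)$ means $Z(\mathcal{H}';\bm\lambda|_{V'})$. Operations: for $F\subseteq E$, $\mathcal{H}-F=(V,E\setminus F)$; for $S\subseteq V$, $\mathcal{H}\ominus S$ is the hypergraph on $V\setminus S$ with hyperedges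 $\{e\setminus S: e\in E, e\not\subseteq S\}$. A linear hypergraph is one where distinct hyperedges share at most one vertex; a path from $v_1$ to $v_2$ is $(u_1,e_1,u_2,\dots,e_{n-1},u_n)$ with distinct vertices, distinct edges and $\{u_i,u_{i+1}\}\subseteq e_i$; a linear hypertree is a linear hypergraph with a unique path between any two vertices. Weitz-hypertree (defined recursively): given $\mathcal{H}$ and $v\in V(\mathcal{H})$, if $\mathcal{H}$ is a linear hypertree, then $\mathcal{T}=\mathcal{H}$, $r=v$, $\pi=\mathrm{id}$. Otherwise let $e_1,\dots,e_d$ be the hyperedges containing $v$ (in a fixed order), write $e_i=\{v,v^{(i)}_1,\dots,v^{(i)}_{b_i}\}$, and for $j=1,\dots,b_i$ let $(\mathcal{T}^{(i)}_j,r^{(i)}_j)$ with labeling $\pi^{(i)}_j$ be the Weitz-hypertree, at $v^{(i)}_j$, of the connected component of $v^{(i)}_j$ in $\mathcal{H}^{(i)}_j=(\mathcal{H}-\{e_1,\dots,e_i\})\ominus\{v,v^{(i)}_1,\dots,v^{(i)}_{j-1}\}$. Then $\mathcal{T}$ is obtained from the disjoint union of all $\mathcal{T}^{(i)}_j$ by adding a new vertex $r$ and the hyperedges $\{r,r^{(i)}_1,\dots,r^{(i)}_{b_i}\}$ for $i=1,\dots,d$; $\pi(r)=v$ and $\pi(u)=\pi^{(i)}_j(u)$ for $u\in V(\mathcal{T}^{(i)}_j)$. -}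

module Defs where

open import Level using (0ℓ)
open import Function using (_∘_)
open import Data.Bool using (Bool; true; false)
open import Data.Nat using (ℕ; zero; suc; _∸_; _≤_)
import Data.Nat as ℕ
open import Data.List using (List; []; _∷_; map; filter; concatMap; _++_; take; length; foldr; deduplicate)
open import Data.List.Membership.Propositional using (_∈_)
import Data.List.Membership.DecPropositional as DecMem
open import Data.List.Relation.Unary.All using (All; all?)
open import Data.List.Relation.Unary.Any using (any?)
open import Data.List.Relation.Unary.AllPairs using (AllPairs)
open import Data.List.Relation.Unary.Unique.Propositional using (Unique)
import Data.List.Properties as ListP
open import Data.Product using (_×_; _,_; proj₁; proj₂; ∃₂)
open import Relation.Binary.PropositionalEquality using (_≡_; _≢_; refl)
open import Relation.Binary.Definitions using (DecidableEquality)
open import Relation.Nullary using (Dec; yes; no; ¬_; ¬?)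
open import Relation.Nullary.Decidable using (_×-dec_; _⊎-dec_)
open import Algebra.Bundles using (CommutativeRing)

-- Hypergraphs over a vertex type A.  Finite sets are represented by
-- lists; 'WellFormed' makes the representation faithful (no repeated
-- vertices, every hyperedge a nonempty subset of V without repetitions,
-- and no two hyperedges equal as sets).

record Hypergraph (A : Set) : Set where
  constructor hg
  field
    V : List A
    E : List (List A)
open Hypergraph public

SameSet : {A : Set} → List A → List A → Set
SameSet e f = (∀ {x} → x ∈ e → x ∈ f) × (∀ {x} → x ∈ f → x ∈ e)

record WellFormed {A : Set} (H : Hypergraph A) : Set where
  field
    V-unique       : Unique (V H)
    E-nonempty     : All (λ e → e ≢ []) (E H)
    E-⊆V           : All (All (_∈ V H)) (E H)
    E-unique       : All Unique (E H)
    E-distinct     : AllPairs (λ e f → ¬ SameSet e f) (E H)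

data Walk {A : Set} (H : Hypergraph A) : A → A → List A → List (List A) → Set where
  here : ∀ {u} → u ∈ V H → Walk H u u (u ∷ []) []
  step : ∀ {u w y us es e} → e ∈ E H → u ∈ e → w ∈ e →
         Walk H w y (w ∷ us) es → Walk H u y (u ∷ w ∷ us) (e ∷ es)

IsPath : {A : Set} → Hypergraph A → A → A → List A → List (List A) → Set
IsPath H x y us es = Walk H x y us es × Unique us × Unique es

IsLinear : {A : Set} → Hypergraph A → Set
IsLinear H = ∀ {e f x y} → e ∈ E H → f ∈ E H → e ≢ f →
             x ∈ e → y ∈ e → x ∈ f → y ∈ f → x ≡ y

IsLinearHypertree : {A : Set} → Hypergraph A → Set
IsLinearHypertree H =
  IsLinear H ×
  (∀ {x y} → x ∈ V H → y ∈ V H →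
     (∃₂ λ us es → IsPath H x y us es) ×
     (∀ {us es us' es'} → IsPath H x y us es → IsPath H x y us' es' →
        us ≡ us' × es ≡ es'))

module Ops {A : Set} (_≟_ : DecidableEquality A) where
  open DecMem _≟_ using (_∈?_)

  _⊆?_ : (xs ys : List A) → Dec (All (_∈ ys) xs)
  xs ⊆? ys = all? (_∈? ys) xs

  sameSet? : (e f : List A) → Dec (All (_∈ f) e × All (_∈ e) f)
  sameSet? e f = (e ⊆? f) ×-dec (f ⊆? e)

  degree : Hypergraph A → A → ℕ
  degree H u = length (filter (u ∈?_) (E H))

  removeFirst : ℕ → A → List (List A) → List (List A)
  removeFirst zero    v es       = es
  removeFirst (suc i) v []       = []
  removeFirst (suc i) v (e ∷ es) with v ∈? e
  ... | yes _ = removeFirst i v es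
  ... | no  _ = e ∷ removeFirst (suc i) v es

  deleteEdges : ℕ → A → Hypergraph A → Hypergraph A
  deleteEdges i v H = hg (V H) (removeFirst i v (E H))

  _⊖_ : Hypergraph A → List A → Hypergraph A
  H ⊖ S = hg (filter (λ x → ¬? (x ∈? S)) (V H))
             (deduplicate sameSet?
               (map (filter (λ x → ¬? (x ∈? S)))
                    (filter (λ e → ¬? (e ⊆? S)) (E H))))

  closeStep : Hypergraph A → List A → List A
  closeStep H C = filter (λ x → (x ∈? C) ⊎-dec any? (λ e → (x ∈? e) ×-dec any? (_∈? C) e) (E H)) (V H)

  iterate : ℕ → Hypergraph A → List A → List A
  iterate zero    H C = C
  iterate (suc n) H C = iterate n H (closeStep H C)

  component : Hypergraph A → A → Hypergraph A
  component H u = hg (filter (_∈? C) (V H)) (filter (_⊆? C) (E H))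
    where C = iterate (length (V H)) H (u ∷ [])

-- Independent sets and partition functions, with values in an arbitrary
-- commutative ring (identities holding in every commutative ring are
-- exactly polynomial identities over ℤ).

subsets : {A : Set} → List A → List (List A)
subsets []       = [] ∷ []
subsets (x ∷ xs) = map (x ∷_) (subsets xs) ++ subsets xs

module Partition (R : CommutativeRing 0ℓ 0ℓ) {A : Set} (_≟_ : DecidableEquality A) where
  open CommutativeRing R
  open DecMem _≟_ using (_∈?_)
  open Ops _≟_ using (_⊆?_)

  independent? : (H : Hypergraph A) → (U : List A) → Dec (All (λ e → ¬ All (_∈ U) e) (E H))
  independent? H U = all? (λ e → ¬? (e ⊆? U)) (E H)

  Σ' : List Carrier → Carrier
  Σ' = foldr _+_ 0#

  Π' : List Carrier → Carrier
  Π' = foldr _*_ 1#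

  Z : Hypergraph A → (A → Carrier) → Carrier
  Z H w = Σ' (map (Π' ∘ map w) (filter (independent? H) (subsets (V H))))

  Zin : Hypergraph A → A → (A → Carrier) → Carrier
  Zin H v w = Σ' (map (Π' ∘ map w)
                 (filter (λ U → v ∈? U) (filter (independent? H) (subsets (V H)))))

  Zout : Hypergraph A → A → (A → Carrier) → Carrier
  Zout H v w = Z H w - Zin H v w

-- The Weitz-hypertree.  Tree vertices are pairs (address , label); the
-- labeling π is proj₂.  A subtree T⁽ⁱ⁾ⱼ built at address p lives at
-- address p ++ [i , j]; this realises the disjoint union.  The order of
-- the hyperedges at v (and of the vertices inside a hyperedge) is the
-- list order.

TVertex : Set → Set
TVertex A = List ℕ × A

module Weitz {A : Set} (_≟_ : DecidableEquality A)
             (dec : (H : Hypergraph A) → Dec (IsLinearHypertree H)) where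
  open DecMem _≟_ using (_∈?_)
  open Ops _≟_

  _≟T_ : DecidableEquality (TVertex A)
  (p , a) ≟T (q , b) with ListP.≡-dec ℕ._≟_ p q | a ≟ b
  ... | yes refl | yes refl = yes refl
  ... | no p≢q   | _        = no λ { refl → p≢q refl }
  ... | yes _    | no a≢b   = no λ { refl → a≢b refl }

  enum : {B : Set} → List B → List (ℕ × B)
  enum = go 1
    where
    go : {B : Set} → ℕ → List B → List (ℕ × B)
    go n []       = []
    go n (x ∷ xs) = (n , x) ∷ go (suc n) xs

  lift : List ℕ → Hypergraph A → Hypergraph (TVertex A)
  lift p H = hg (map (p ,_) (V H)) (map (map (p ,_)) (E H))

  -- fuel-driven recursion; the root of 'build k p H v' is (p , v).
  -- The number of hyperedges strictly decreases in each recursive call,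
  -- so fuel (number of hyperedges + 1) is always sufficient.
  build : ℕ → List ℕ → Hypergraph A → A → Hypergraph (TVertex A)
  build zero    p H v = lift p H
  build (suc k) p H v with dec H
  ... | yes _ = lift p H
  ... | no  _ = hg ((p , v) ∷ concatMap V subtrees) (concatMap E subtrees ++ rootEdges)
    where
    nbrs : List (ℕ × List A)
    nbrs = map (λ (i , e) → i , filter (λ u → ¬? (u ≟ v)) e) (enum (filter (v ∈?_) (E H)))

    subtree : ℕ → List A → ℕ × A → Hypergraph (TVertex A)
    subtree i os (j , u) =
      build k (p ++ i ∷ j ∷ [])
            (component (deleteEdges i v H ⊖ (v ∷ take (j ∸ 1) os)) u) u

    subtrees : List (Hypergraph (TVertex A))
    subtrees = concatMap (λ (i , os) → map (subtree i os) (enum os)) nbrs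

    rootEdges : List (List (TVertex A))
    rootEdges = map (λ (i , os) → (p , v) ∷ map (λ (j , u) → (p ++ i ∷ j ∷ [] , u)) (enum os)) nbrs

  tree : Hypergraph A → A → Hypergraph (TVertex A)
  tree H v = build (suc (length (E H))) [] H v

  root : A → TVertex A
  root v = ([] , v)

  π : TVertex A → A
  π = proj₂

{-# OPTIONS --safe #-}
module Submission where

-- Nothing can be cancelled in an arbitrary commutative ring, so the identity of ratios is
-- strengthened to divisibility: for some union X ∋ v of components of H and some ring element Q,
-- Z(T) = Q Z(H[X]) and Z_in(T) = Q Z_in(H[X]); the rest of H contributes one common factor.
-- Inductively, telescoping over the vertices v₁, …, v_b of an edge gives a set Y and a q with
-- ∏ⱼ Z(Tⱼ) = q Z(G[Y]) and ∏ⱼ Z_in(Tⱼ) = q Z(G[Y]; all vⱼ in), so their difference is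
-- q Z(G[Y] + {v₁, …, v_b}). Telescoping over the edges at v adds the edges back one at a time.
-- At either level, the sets X and Y of two consecutive stages are merged to X ∪ Y, and the
-- multiplier picks up the partition function of the overlap X ∩ Y.

open import Defs
open import Level using (0ℓ)
open import Data.Empty using (⊥; ⊥-elim)
open import Data.Nat using (ℕ; zero; suc; _∸_; _≤_; _<_; _<?_)
import Data.Nat as ℕ
open import Data.Nat.Properties
  using (≤-trans; ≤-refl; ≤-reflexive; <⇒≱; <⇒≢; +-suc; +-monoʳ-≤; m≤m+n; n≤1+n)
open import Data.List using (List; []; _∷_; _++_; map; filter; length; take; drop; concatMap)
open import Data.List.Membership.Propositional using (_∈_; _∉_; find; lose)
open import Data.List.Membership.Propositional.Properties
  using (∈-filter⁺; ∈-filter⁻; ∈-++⁺ˡ; ∈-++⁺ʳ; ∈-++⁻; ∈-map⁺; ∈-map⁻)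
open import Data.List.Membership.Propositional.Properties.WithK using (unique∧set⇒bag)
import Data.List.Membership.DecPropositional as DecMembership
open import Data.List.Properties
  using (map-++; map-∘; length-filter; concatMap-++; ++-assoc; ++-cancelˡ; ++-identityʳ)
open import Data.List.Relation.Binary.BagAndSetEquality using (∼bag⇒↭)
open import Data.List.Relation.Binary.Disjoint.Propositional using (Disjoint)
open import Data.List.Relation.Binary.Permutation.Propositional using (_↭_; prep; swap)
import Data.List.Relation.Binary.Permutation.Propositional as Perm
open import Data.List.Relation.Binary.Permutation.Propositional.Properties
  using (∈-resp-↭; ↭-length)
open import Data.List.Relation.Binary.Subset.Propositional using (_⊆_)
open import Data.List.Relation.Unary.All as All using (All; []; _∷_; all?)
open import Data.List.Relation.Unary.AllPairs using ([]; _∷_)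
open import Data.List.Relation.Unary.Any as Any using (Any; here; there; any?)
import Data.List.Relation.Unary.Any.Properties as AnyP
open import Data.List.Relation.Unary.Unique.Propositional using (Unique)
import Data.List.Relation.Unary.Unique.Propositional.Properties as Unique
open import Data.Product using (_×_; _,_; proj₁; proj₂; ∃-syntax)
open import Data.Sum using (_⊎_; inj₁; inj₂; [_,_]′)
import Data.Sum as Sum
open import Function using (_∘_; id; _⇔_; mk⇔; Equivalence)
open import Relation.Binary.PropositionalEquality as ≡ using (_≡_; _≢_; refl)
open import Relation.Binary.Definitions using (DecidableEquality)
open import Relation.Nullary using (Dec; yes; no; ¬_; ¬?; contradiction)
open import Relation.Nullary.Decidable using (_×-dec_; _⊎-dec_; map′)
open import Relation.Unary using (Decidable)
open import Algebra.Bundles using (CommutativeRing)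

-- If division were allowed, force v in and let zᵢ be the partition function of the rest after e₁,
-- ..., eᵢ are deleted. Then Z_in/Z_out is λ_v times the product of all zᵢ₋₁/zᵢ, and zᵢ₋₁/zᵢ = 1 -
-- ∏ⱼ pⱼ, where pⱼ is the share of configurations with vⱼ in, given that v₁, ..., vⱼ₋₁ are in. The
-- tree obeys the same recursion, with genuine products because its subtrees are disjoint. The set X
-- cannot be fixed in advance as the component of v: vⱼ may or may not share a component with
-- earlier vertices, and removing those can split it further, so each subtree sees its own piece of
-- the hypergraph. To compare pieces, all of them are kept inside one vertex list and one edge list:
-- `⊖ S` becomes forcing S in, and being a union of components becomes `Closed`. Forcing and `⊖`
-- disagree on an edge swallowed by S: forcing gives zero, `⊖` discards the edge. The zero is
-- supplied by another factor: for an edge completed by a neighbour u, the one at u, where its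
-- residual is {u}; for an edge {v}, its own factor at the root. Hence the filter `⟍` in `Rep`.

module _ {A : Set} where

  -- `S` stands for the forced vertices and `U` for the chosen ones, so a covered edge is one that
  -- the configuration violates.
  Cov : List A → List A → List A → Set
  Cov e S U = ∀ {x} → x ∈ e → x ∈ S ⊎ x ∈ U

  Feasible : List (List A) → List A → List A → List A → Set
  Feasible E S K U = (∀ {e} → e ∈ E → ¬ Cov e S U) × K ⊆ U

  -- For `X` disjoint from `S` this says that `X` is a union of components once `S` is removed: no
  -- edge leaves `X` except into `S`.
  Closed : List (List A) → List A → List A → Set
  Closed E S X = ∀ {e} → e ∈ E → Cov e S X ⊎ Disjoint e X

-- Finite sets as duplicate-free lists.

module FiniteSets {A : Set} (_≟_ : DecidableEquality A) where
  open DecMembership _≟_ public using (_∈?_)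

  abstract
    cov? : (e S U : List A) → Dec (Cov e S U)
    cov? e S U = map′ All.lookup All.tabulate (all? (λ x → (x ∈? S) ⊎-dec (x ∈? U)) e)

    _⊆ₗ?_ : (X Y : List A) → Dec (X ⊆ Y)
    X ⊆ₗ? Y = map′ All.lookup All.tabulate (all? (_∈? Y) X)

    feasible? : (E : List (List A)) (S K : List A) → Decidable (Feasible E S K)
    feasible? E S K U =
      map′ All.lookup All.tabulate (all? (λ e → ¬? (cov? e S U)) E) ×-dec (K ⊆ₗ? U)

  infixl 7 _∩_ _∖_

  _∩_ _∖_ : List A → List A → List A
  X ∩ Y = filter (_∈? Y) X
  X ∖ Y = filter (λ x → ¬? (x ∈? Y)) X

  module _ {X Y : List A} where
    ∈∩⁻ : ∀ {x} → x ∈ X ∩ Y → x ∈ X × x ∈ Y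
    ∈∩⁻ = ∈-filter⁻ (_∈? Y) {xs = X}

    ∈∩⁺ : ∀ {x} → x ∈ X → x ∈ Y → x ∈ X ∩ Y
    ∈∩⁺ = ∈-filter⁺ (_∈? Y)

    ∈∖⁻ : ∀ {x} → x ∈ X ∖ Y → x ∈ X × x ∉ Y
    ∈∖⁻ = ∈-filter⁻ (λ x → ¬? (x ∈? Y)) {xs = X}

    ∈∖⁺ : ∀ {x} → x ∈ X → x ∉ Y → x ∈ X ∖ Y
    ∈∖⁺ = ∈-filter⁺ (λ x → ¬? (x ∈? Y))

  module _ (X Y : List A) where
    ∖-disjoint : Disjoint X (Y ∖ X)
    ∖-disjoint (p , q) = proj₂ (∈∖⁻ {Y} q) p

    ∩-∖-sameSet : SameSet X (X ∩ Y ++ X ∖ Y)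
    ∩-∖-sameSet = to , from
      where
      to : X ⊆ X ∩ Y ++ X ∖ Y
      to {x} p with x ∈? Y
      ... | yes q = ∈-++⁺ˡ (∈∩⁺ p q)
      ... | no q  = ∈-++⁺ʳ (X ∩ Y) (∈∖⁺ p q)
      from : X ∩ Y ++ X ∖ Y ⊆ X
      from p with ∈-++⁻ (X ∩ Y) p
      ... | inj₁ q = proj₁ (∈∩⁻ {X} q)
      ... | inj₂ q = proj₁ (∈∖⁻ {X} q)

  sameSet⇒↭ : ∀ {X Y : List A} → Unique X → Unique Y → SameSet X Y → X ↭ Y
  sameSet⇒↭ uX uY (p , q) = ∼bag⇒↭ (unique∧set⇒bag uX uY (mk⇔ p q))

  unique-⊆⇒length-≤ : ∀ {X Y : List A} → Unique X → Unique Y → X ⊆ Y → length X ≤ length Y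
  unique-⊆⇒length-≤ {X} {Y} uX uY X⊆Y =
    ≤-trans (≤-reflexive (↭-length (sameSet⇒↭ uX (Unique.filter⁺ (_∈? X) uY)
              ((λ p → ∈∩⁺ (X⊆Y p) p) , (proj₂ ∘ ∈∩⁻ {Y})))))
            (length-filter (_∈? X) Y)

-- Indicators and weighted sums over subsets.

module Indicators (R : CommutativeRing 0ℓ 0ℓ) where
  open CommutativeRing R renaming (refl to ≈-refl; sym to ≈-sym; trans to ≈-trans)

  ι : {P : Set} → Dec P → Carrier
  ι (yes _) = 1#
  ι (no _)  = 0#

  ι-cong : {P Q : Set} (p? : Dec P) (q? : Dec Q) → P ⇔ Q → ι p? ≈ ι q?
  ι-cong (yes _) (yes _) _ = ≈-refl
  ι-cong (yes p) (no ¬q) f = contradiction (Equivalence.to f p) ¬q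
  ι-cong (no ¬p) (yes q) f = contradiction (Equivalence.from f q) ¬p
  ι-cong (no _)  (no _)  _ = ≈-refl

  ι-× : {P Q T : Set} (t? : Dec T) (p? : Dec P) (q? : Dec Q) → T ⇔ (P × Q) → ι t? ≈ ι p? * ι q?
  ι-× t? (yes p) (yes q) f = ≈-trans (ι-cong t? (yes (p , q)) f) (≈-sym (*-identityˡ 1#))
  ι-× t? (yes _) (no ¬q) f = ≈-trans (ι-cong t? (no (¬q ∘ proj₂)) f) (≈-sym (zeroʳ 1#))
  ι-× t? (no ¬p) q?      f = ≈-trans (ι-cong t? (no (¬p ∘ proj₁)) f) (≈-sym (zeroˡ _))

module Sums (R : CommutativeRing 0ℓ 0ℓ) {A : Set} (_≟_ : DecidableEquality A)
            (w : A → CommutativeRing.Carrier R) where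
  open CommutativeRing R renaming (refl to ≈-refl; sym to ≈-sym; trans to ≈-trans)
  open import Relation.Binary.Reasoning.Setoid setoid
  open FiniteSets _≟_
  open Partition R _≟_ using (Z; Zin; Σ'; Π'; independent?)
  open Indicators R public

  -- Recursion over the vertices instead of an enumerated list of subsets makes factorisation over
  -- `X ++ Y` a plain induction; indicators inside `F` take the place of filtering.
  Sum : List A → (List A → Carrier) → Carrier
  Sum []      F = F []
  Sum (x ∷ X) F = w x * Sum X (F ∘ (x ∷_)) + Sum X F

  Sum-cong : ∀ X {F G} → (∀ {U} → U ⊆ X → F U ≈ G U) → Sum X F ≈ Sum X G
  Sum-cong []      eq = eq id
  Sum-cong (x ∷ X) eq = +-cong
    (*-congˡ (Sum-cong X λ U⊆X → eq λ { (here p) → here p ; (there p) → there (U⊆X p) }))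
    (Sum-cong X λ U⊆X → eq (there ∘ U⊆X))

  Sum-* : ∀ X c F → Sum X (λ U → c * F U) ≈ c * Sum X F
  Sum-* []      c F = ≈-refl
  Sum-* (x ∷ X) c F = begin
    w x * Sum X (λ U → c * F (x ∷ U)) + Sum X (λ U → c * F U)
      ≈⟨ +-cong (*-congˡ (Sum-* X c (F ∘ (x ∷_)))) (Sum-* X c F) ⟩
    w x * (c * S₁) + c * S₂   ≈⟨ +-congʳ (≈-sym (*-assoc (w x) c S₁)) ⟩
    w x * c * S₁ + c * S₂     ≈⟨ +-congʳ (*-congʳ (*-comm (w x) c)) ⟩
    c * w x * S₁ + c * S₂     ≈⟨ +-congʳ (*-assoc c (w x) S₁) ⟩
    c * (w x * S₁) + c * S₂   ≈⟨ distribˡ c _ _ ⟨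
    c * (w x * S₁ + S₂)       ∎
    where
    S₁ = Sum X (F ∘ (x ∷_))
    S₂ = Sum X F

  Sum-+ : ∀ X F G → Sum X (λ U → F U + G U) ≈ Sum X F + Sum X G
  Sum-+ []      F G = ≈-refl
  Sum-+ (x ∷ X) F G = begin
    w x * Sum X (λ U → F (x ∷ U) + G (x ∷ U)) + Sum X (λ U → F U + G U)
      ≈⟨ +-cong (*-congˡ (Sum-+ X _ _)) (Sum-+ X F G) ⟩
    w x * (F₁ + G₁) + (F₂ + G₂)          ≈⟨ +-congʳ (distribˡ (w x) F₁ G₁) ⟩
    (w x * F₁ + w x * G₁) + (F₂ + G₂)    ≈⟨ medial _ _ _ _ ⟩
    (w x * F₁ + F₂) + (w x * G₁ + G₂)    ∎
    where
    open import Algebra.Properties.CommutativeSemigroup +-commutativeSemigroup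
      using () renaming (interchange to medial)
    F₁ = Sum X (F ∘ (x ∷_))
    G₁ = Sum X (G ∘ (x ∷_))
    F₂ = Sum X F
    G₂ = Sum X G

  Sum-0 : ∀ X {F} → (∀ {U} → U ⊆ X → F U ≈ 0#) → Sum X F ≈ 0#
  Sum-0 X {F} F≈0 = begin
    Sum X F                 ≈⟨ Sum-cong X (λ U⊆X → ≈-trans (F≈0 U⊆X) (≈-sym (zeroˡ 0#))) ⟩
    Sum X (λ _ → 0# * 0#)   ≈⟨ Sum-* X 0# (λ _ → 0#) ⟩
    0# * Sum X (λ _ → 0#)   ≈⟨ zeroˡ _ ⟩
    0#                      ∎

  Sum-++ : ∀ X Y {F G H} → (∀ {U₁ U₂} → U₁ ⊆ X → U₂ ⊆ Y → F (U₁ ++ U₂) ≈ G U₁ * H U₂) →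
           Sum (X ++ Y) F ≈ Sum X G * Sum Y H
  Sum-++ []      Y {F} {G} {H} eq = ≈-trans (Sum-cong Y (eq id)) (Sum-* Y (G []) H)
  Sum-++ (x ∷ X) Y {F} {G} {H} eq = begin
    w x * Sum (X ++ Y) (F ∘ (x ∷_)) + Sum (X ++ Y) F
      ≈⟨ +-cong (*-congˡ (Sum-++ X Y λ U₁⊆X → eq λ { (here p) → here p ; (there p) → there (U₁⊆X p) }))
                (Sum-++ X Y λ U₁⊆X → eq (there ∘ U₁⊆X)) ⟩
    w x * (Sum X (G ∘ (x ∷_)) * Sum Y H) + Sum X G * Sum Y H
      ≈⟨ +-congʳ (≈-sym (*-assoc _ _ _)) ⟩
    w x * Sum X (G ∘ (x ∷_)) * Sum Y H + Sum X G * Sum Y H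
      ≈⟨ distribʳ _ _ _ ⟨
    (w x * Sum X (G ∘ (x ∷_)) + Sum X G) * Sum Y H ∎

  -- Subsets are lists, so reordering the ground set reorders every `U`; the summand must not
  -- notice.
  Ext : (List A → Carrier) → Set
  Ext F = ∀ {U U'} → U ↭ U' → F U ≈ F U'

  Sum-↭ : ∀ {X Y} F → Ext F → X ↭ Y → Sum X F ≈ Sum Y F
  Sum-↭ F ext Perm.refl = ≈-refl
  Sum-↭ F ext (prep x p) = +-cong (*-congˡ (Sum-↭ (F ∘ (x ∷_)) (ext ∘ prep x) p)) (Sum-↭ F ext p)
  Sum-↭ F ext (Perm.trans p q) = ≈-trans (Sum-↭ F ext p) (Sum-↭ F ext q)
  Sum-↭ F ext (swap {X} {Y} x y p) = begin
    w x * (w y * a X (λ U → x ∷ y ∷ U) + a X (x ∷_)) + (w y * a X (y ∷_) + a X id)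
      ≈⟨ +-congʳ (≈-trans (distribˡ _ _ _) (+-congʳ (lemma (w x) (w y) _))) ⟩
    (w y * (w x * a X (λ U → x ∷ y ∷ U)) + w x * a X (x ∷_)) + (w y * a X (y ∷_) + a X id)
      ≈⟨ medial _ _ _ _ ⟩
    (w y * (w x * a X (λ U → x ∷ y ∷ U)) + w y * a X (y ∷_)) + (w x * a X (x ∷_) + a X id)
      ≈⟨ +-congʳ (≈-sym (distribˡ _ _ _)) ⟩
    w y * (w x * a X (λ U → x ∷ y ∷ U) + a X (y ∷_)) + (w x * a X (x ∷_) + a X id)
      ≈⟨ +-cong (*-congˡ (+-cong (*-congˡ
            (≈-trans (Sum-cong X λ _ → ext (swap x y Perm.refl))
                     (Sum-↭ _ (ext ∘ prep y ∘ prep x) p)))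
            (Sum-↭ _ (ext ∘ prep y) p)))
          (+-cong (*-congˡ (Sum-↭ _ (ext ∘ prep x) p)) (Sum-↭ F ext p)) ⟩
    w y * (w x * a Y (λ U → y ∷ x ∷ U) + a Y (y ∷_)) + (w x * a Y (x ∷_) + a Y id) ∎
    where
    open import Algebra.Properties.CommutativeSemigroup +-commutativeSemigroup
      using () renaming (interchange to medial)
    open import Algebra.Properties.CommutativeSemigroup *-commutativeSemigroup
      using () renaming (x∙yz≈y∙xz to lemma)
    a : List A → (List A → List A) → Carrier
    a X f = Sum X (F ∘ f)

  -- The sum over the sets U ⊆ X with K ⊆ U and no edge of E inside S ∪ U:
  -- the vertices of S are forced into the independent set, but carry no weight.
  Zs : List (List A) → List A → List A → List A → Carrier
  Zs E S K X = Sum X (λ U → ι (feasible? E S K U))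

  Zs-cong : ∀ {E S K E' S' K' X} →
    (∀ {U} → U ⊆ X → Feasible E S K U ⇔ Feasible E' S' K' U) → Zs E S K X ≈ Zs E' S' K' X
  Zs-cong {E} {S} {K} {E'} {S'} {K'} {X} eq = Sum-cong X λ {U} U⊆X →
    ι-cong (feasible? E S K U) (feasible? E' S' K' U) (eq U⊆X)

  Zs-↭ : ∀ E S K {X Y} → X ↭ Y → Zs E S K X ≈ Zs E S K Y
  Zs-↭ E S K = Sum-↭ _ λ {U} {U'} p →
    ι-cong (feasible? E S K U) (feasible? E S K U') (mk⇔ (resp p) (resp (Perm.↭-sym p)))
    where
    resp : ∀ {U U'} → U ↭ U' → Feasible E S K U → Feasible E S K U'
    resp p (ind , K⊆U) =
      (λ e∈E cov → ind e∈E (Sum.map₂ (∈-resp-↭ (Perm.↭-sym p)) ∘ cov)) , ∈-resp-↭ p ∘ K⊆U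

  Zs-++ : ∀ {E S K E₁ S₁ K₁ E₂ S₂ K₂ X Y} →
    (∀ {U₁ U₂} → U₁ ⊆ X → U₂ ⊆ Y →
      Feasible E S K (U₁ ++ U₂) ⇔ (Feasible E₁ S₁ K₁ U₁ × Feasible E₂ S₂ K₂ U₂)) →
    Zs E S K (X ++ Y) ≈ Zs E₁ S₁ K₁ X * Zs E₂ S₂ K₂ Y
  Zs-++ {E} {S} {K} {E₁} {S₁} {K₁} {E₂} {S₂} {K₂} {X} {Y} eq =
    Sum-++ X Y λ {U₁} {U₂} p q →
      ι-× (feasible? E S K (U₁ ++ U₂)) (feasible? E₁ S₁ K₁ U₁) (feasible? E₂ S₂ K₂ U₂) (eq p q)

  -- The common shape of the factorisations on the hypergraph side. The three sums may differ in
  -- edges, forced vertices and requirements; what is left to each use is that feasibility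
  -- decouples.
  Zs-split : ∀ {E S K E₁ S₁ K₁ E₂ S₂ K₂ W X Y} →
    Unique W → Unique X → Unique Y → Disjoint X Y → SameSet W (X ++ Y) →
    (∀ {U₁ U₂} → U₁ ⊆ X → U₂ ⊆ Y →
      Feasible E S K (U₁ ++ U₂) ⇔ (Feasible E₁ S₁ K₁ U₁ × Feasible E₂ S₂ K₂ U₂)) →
    Zs E S K W ≈ Zs E₁ S₁ K₁ X * Zs E₂ S₂ K₂ Y
  Zs-split {E} {S} {K} {E₁} {S₁} {K₁} {E₂} {S₂} {K₂} uW uX uY disj W~ eq =
    ≈-trans (Zs-↭ E S K (sameSet⇒↭ uW (Unique.++⁺ uX uY disj) W~))
            (Zs-++ {E} {S} {K} {E₁} {S₁} {K₁} {E₂} {S₂} {K₂} eq)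

  -- From the partition functions of the statement to weighted sums.

  Σ-filter : {P : List A → Set} (P? : Decidable P) (f : List A → Carrier) (Us : List (List A)) →
    Σ' (map f (filter P? Us)) ≈ Σ' (map (λ U → ι (P? U) * f U) Us)
  Σ-filter P? f []       = ≈-refl
  Σ-filter P? f (U ∷ Us) with P? U
  ... | yes _ = +-cong (≈-sym (*-identityˡ _)) (Σ-filter P? f Us)
  ... | no _  = ≈-trans (Σ-filter P? f Us) (≈-sym (≈-trans (+-congʳ (zeroˡ _)) (+-identityˡ _)))

  Σ-++ : ∀ xs ys → Σ' (xs ++ ys) ≈ Σ' xs + Σ' ys
  Σ-++ []       ys = ≈-sym (+-identityˡ _)
  Σ-++ (x ∷ xs) ys = ≈-trans (+-congˡ (Σ-++ xs ys)) (≈-sym (+-assoc _ _ _))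

  Σ-map : ∀ {B : Set} {f g : B → Carrier} → (∀ x → f x ≈ g x) → ∀ xs → Σ' (map f xs) ≈ Σ' (map g xs)
  Σ-map eq []       = ≈-refl
  Σ-map eq (x ∷ xs) = +-cong (eq x) (Σ-map eq xs)

  Σ-* : ∀ {B : Set} c (f : B → Carrier) xs → Σ' (map (λ x → c * f x) xs) ≈ c * Σ' (map f xs)
  Σ-* c f []       = ≈-sym (zeroʳ c)
  Σ-* c f (x ∷ xs) = ≈-trans (+-congˡ (Σ-* c f xs)) (≈-sym (distribˡ c _ _))

  Σ-subsets : ∀ X F → Σ' (map (λ U → F U * Π' (map w U)) (subsets X)) ≈ Sum X F
  Σ-subsets []      F = ≈-trans (+-identityʳ _) (*-identityʳ _)
  Σ-subsets (x ∷ X) F = begin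
    Σ' (map g (map (x ∷_) (subsets X) ++ subsets X))
      ≡⟨ ≡.cong Σ' (map-++ g (map (x ∷_) (subsets X)) (subsets X)) ⟩
    Σ' (map g (map (x ∷_) (subsets X)) ++ map g (subsets X))
      ≈⟨ Σ-++ (map g (map (x ∷_) (subsets X))) _ ⟩
    Σ' (map g (map (x ∷_) (subsets X))) + Σ' (map g (subsets X))
      ≡⟨ ≡.cong (λ l → Σ' l + Σ' (map g (subsets X))) (≡.sym (map-∘ (subsets X))) ⟩
    Σ' (map (g ∘ (x ∷_)) (subsets X)) + Σ' (map g (subsets X))
      ≈⟨ +-congʳ (≈-trans (Σ-map (λ U → lemma _ (w x) _) (subsets X)) (Σ-* (w x) _ (subsets X))) ⟩
    w x * Σ' (map (λ U → F (x ∷ U) * Π' (map w U)) (subsets X)) + Σ' (map g (subsets X))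
      ≈⟨ +-cong (*-congˡ (Σ-subsets X (F ∘ (x ∷_)))) (Σ-subsets X F) ⟩
    w x * Sum X (F ∘ (x ∷_)) + Sum X F ∎
    where
    open import Algebra.Properties.CommutativeSemigroup *-commutativeSemigroup
      using () renaming (x∙yz≈y∙xz to lemma)
    g : List A → Carrier
    g U = F U * Π' (map w U)

  independent⇔ : ∀ (E : List (List A)) (U : List A) → All (λ e → ¬ All (_∈ U) e) E ⇔ Feasible E [] [] U
  independent⇔ E U = mk⇔ to from
    where
    to : All (λ e → ¬ All (_∈ U) e) E → Feasible E [] [] U
    to ind = (λ e∈E cov → All.lookup ind e∈E (All.tabulate ([ (λ ()) , id ]′ ∘ cov))) , λ ()
    from : Feasible E [] [] U → All (λ e → ¬ All (_∈ U) e) E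
    from (ind , _) = All.tabulate λ e∈E sub → ind e∈E (inj₂ ∘ All.lookup sub)

  Z≈Zs : ∀ H → Z H w ≈ Zs (E H) [] [] (V H)
  Z≈Zs H = begin
    Z H w ≈⟨ Σ-filter (independent? H) (Π' ∘ map w) (subsets (V H)) ⟩
    _     ≈⟨ Σ-subsets (V H) (λ U → ι (independent? H U)) ⟩
    _     ≈⟨ Sum-cong (V H) (λ {U} _ → ι-cong (independent? H U) (feasible? (E H) [] [] U)
                                          (independent⇔ (E H) U)) ⟩
    Zs (E H) [] [] (V H) ∎

  Zin≈Zs : ∀ H v → Zin H v w ≈ Zs (E H) [] (v ∷ []) (V H)
  Zin≈Zs H v = begin
    Zin H v w ≈⟨ Σ-filter (v ∈?_) (Π' ∘ map w) (filter (independent? H) (subsets (V H))) ⟩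
    _ ≈⟨ Σ-filter (independent? H) _ (subsets (V H)) ⟩
    _ ≈⟨ Σ-map (λ U → ≈-sym (*-assoc _ _ _)) (subsets (V H)) ⟩
    _ ≈⟨ Σ-subsets (V H) (λ U → ι (independent? H U) * ι (v ∈? U)) ⟩
    _ ≈⟨ Sum-cong (V H) (λ {U} _ → ≈-sym (ι-× (feasible? (E H) [] (v ∷ []) U)
                                          (independent? H U) (v ∈? U) (split U))) ⟩
    Zs (E H) [] (v ∷ []) (V H) ∎
    where
    split : ∀ U → Feasible (E H) [] (v ∷ []) U ⇔ (All (λ e → ¬ All (_∈ U) e) (E H) × v ∈ U)
    split U = mk⇔ to from
      where
      to : Feasible (E H) [] (v ∷ []) U → All (λ e → ¬ All (_∈ U) e) (E H) × v ∈ U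
      to (ind , v⊆) = Equivalence.from (independent⇔ (E H) U) (ind , λ ()) , v⊆ (here refl)
      from : All (λ e → ¬ All (_∈ U) e) (E H) × v ∈ U → Feasible (E H) [] (v ∷ []) U
      from (ind , v∈) = proj₁ (Equivalence.to (independent⇔ (E H) U) ind) , λ { (here refl) → v∈ }

-- Attributing a violated edge to one side of a split.

module _ {A : Set} {e S : List A} where
  cov-++ˡ : ∀ {U₁ U₂} → Cov e S U₁ → Cov e S (U₁ ++ U₂)
  cov-++ˡ cov x∈ = Sum.map₂ ∈-++⁺ˡ (cov x∈)

  cov-++ʳ : ∀ U₁ {U₂} → Cov e S U₂ → Cov e S (U₁ ++ U₂)
  cov-++ʳ U₁ cov x∈ = Sum.map₂ (∈-++⁺ʳ U₁) (cov x∈)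

  cov-dropʳ : ∀ U₁ {U₂} → Cov e S (U₁ ++ U₂) → (∀ {x} → x ∈ e → x ∈ U₂ → x ∈ S) → Cov e S U₁
  cov-dropʳ U₁ cov f x∈ with cov x∈
  ... | inj₁ s = inj₁ s
  ... | inj₂ u with ∈-++⁻ U₁ u
  ...   | inj₁ u₁ = inj₂ u₁
  ...   | inj₂ u₂ = inj₁ (f x∈ u₂)

  cov-dropˡ : ∀ U₁ {U₂} → Cov e S (U₁ ++ U₂) → (∀ {x} → x ∈ e → x ∈ U₁ → x ∈ S) → Cov e S U₂
  cov-dropˡ U₁ cov f x∈ with cov x∈
  ... | inj₁ s = inj₁ s
  ... | inj₂ u with ∈-++⁻ U₁ u
  ...   | inj₁ u₁ = inj₁ (f x∈ u₁)
  ...   | inj₂ u₂ = inj₂ u₂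

-- Common multiples of restricted partition functions.

module Multiples (R : CommutativeRing 0ℓ 0ℓ) {A : Set} (_≟_ : DecidableEquality A)
                 (w : A → CommutativeRing.Carrier R) where
  open CommutativeRing R renaming (refl to ≈-refl; sym to ≈-sym; trans to ≈-trans)
  open import Relation.Binary.Reasoning.Setoid setoid
  open FiniteSets _≟_
  open Sums R _≟_ w
  open import Algebra.Solver.CommutativeMonoid *-commutativeMonoid
    using (solve; _⊜_; _⊕_)

  _⟍_ : List (List A) → List A → List (List A)
  E ⟍ S = filter (λ e → ¬? (e ⊆ₗ? S)) E

  ∈⟍⁻ : ∀ {E S e} → e ∈ E ⟍ S → e ∈ E × ¬ (e ⊆ S)
  ∈⟍⁻ {E} {S} = ∈-filter⁻ (λ e → ¬? (e ⊆ₗ? S)) {xs = E}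

  ∈⟍⁺ : ∀ {E S e} → e ∈ E → ¬ (e ⊆ S) → e ∈ E ⟍ S
  ∈⟍⁺ {E} {S} = ∈-filter⁺ (λ e → ¬? (e ⊆ₗ? S))

  -- An edge inside `S ∪ X` gets nothing new from `W₂`, and one that misses `X` gets nothing from
  -- `W₁`; so any violation is already visible on one side.
  Zs-closed-split : ∀ {E S X W W₁ W₂} → Closed E S X → Unique W → Unique W₁ → Unique W₂ →
    W₁ ⊆ X → Disjoint W₂ X → SameSet W (W₁ ++ W₂) →
    Zs E S [] W ≈ Zs E S [] W₁ * Zs E S [] W₂
  Zs-closed-split {E} {S} {X} {W} {W₁} {W₂} closed uW uW₁ uW₂ W₁⊆X W₂#X same =
    Zs-split {E} {S} {[]} {E} {S} {[]} {E} {S} {[]} uW uW₁ uW₂ (λ (p , q) → W₂#X (q , W₁⊆X p)) same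
      λ {U₁} p q → mk⇔ (to {U₁}) (from p q)
    where
    to : ∀ {U₁ U₂} → Feasible E S [] (U₁ ++ U₂) → Feasible E S [] U₁ × Feasible E S [] U₂
    to {U₁} (ind , _) =
      ((λ e∈ cov → ind e∈ (cov-++ˡ cov)) , λ ()) , ((λ e∈ cov → ind e∈ (cov-++ʳ U₁ cov)) , λ ())
    from : ∀ {U₁ U₂} → U₁ ⊆ W₁ → U₂ ⊆ W₂ →
           Feasible E S [] U₁ × Feasible E S [] U₂ → Feasible E S [] (U₁ ++ U₂)
    from {U₁} {U₂} p q ((ind₁ , _) , (ind₂ , _)) = ind , λ ()
      where
      ind : ∀ {e} → e ∈ E → ¬ Cov e S (U₁ ++ U₂)
      ind e∈ cov with closed e∈
      ... | inj₁ cX = ind₁ e∈ (cov-dropʳ U₁ cov λ x∈e x∈U₂ →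
              [ id , (λ x∈X → contradiction (q x∈U₂ , x∈X) W₂#X) ]′ (cX x∈e))
      ... | inj₂ e#X = ind₂ e∈ (cov-dropˡ U₁ cov λ x∈e x∈U₁ →
              contradiction (x∈e , W₁⊆X (p x∈U₁)) e#X)

  -- Edges inside S are dropped (E ⟍ S), as ⊖ does, although forcing S would make Zs vanish.
  record Rep (V : List A) (E : List (List A)) (S K : List A) (a b : Carrier) : Set where
    field
      X        : List A
      X-unique : Unique X
      X⊆V      : X ⊆ V
      K⊆X      : K ⊆ X
      X#S      : Disjoint X S
      closed   : Closed E S X
      Q        : Carrier
      a≈       : a ≈ Q * Zs (E ⟍ S) S [] X
      b≈       : b ≈ Q * Zs (E ⟍ S) S K X

  -- The end of the telescoping over vertices. The value 1 relies on `⟍`: an edge kept inside `S`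
  -- would make the empty choice infeasible.
  Rep-empty : ∀ {V E S} → Rep V E S [] 1# 1#
  Rep-empty {E = E} {S} = record
    { X = [] ; X-unique = [] ; X⊆V = λ () ; K⊆X = λ () ; X#S = λ () ; closed = λ _ → inj₂ λ ()
    ; Q = 1# ; a≈ = one ; b≈ = one }
    where
    feasible : Feasible (E ⟍ S) S [] []
    feasible = (λ e∈ cov → proj₂ (∈⟍⁻ {E} e∈) ([ id , (λ ()) ]′ ∘ cov)) , λ ()
    one : 1# ≈ 1# * Zs (E ⟍ S) S [] []
    one = ≈-sym (≈-trans (*-identityˡ _)
            (ι-cong (feasible? (E ⟍ S) S [] []) (yes feasible) (mk⇔ id id)))

  -- The vertex required in the first factor is forced in the second, so the shares multiply like
  -- conditional probabilities. Both products count the overlap twice. For `a * a'` the surplus is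
  -- cut off `Y`, for `b * b'` it is cut off `X`; either way the piece is `Zs F' S' [] (Y ∩ X)`,
  -- which can therefore move into the multiplier.
  Rep-step : ∀ {V E S u os a b a' b'} → Rep V E S (u ∷ []) a b →
    Rep V E (S ++ u ∷ []) os a' b' → Rep V E S (u ∷ os) (a * a') (b * b')
  Rep-step {V} {E} {S} {u} {os} {a} {b} {a'} {b'} r r' = record
    { X = X ++ Y ∖ X
    ; X-unique = Unique.++⁺ uX (Unique.filter⁺ _ uY) (∖-disjoint X Y)
    ; X⊆V = [ X⊆V , r'.X⊆V ∘ proj₁ ∘ ∈∖⁻ {Y} ]′ ∘ ∈-++⁻ X
    ; K⊆X = λ { (here refl) → ∈-++⁺ˡ u∈X ; (there p) → Y⊆ (r'.K⊆X p) }
    ; X#S = λ (p , q) → [ (λ p → X#S (p , q)) , (λ p → r'.X#S (proj₁ (∈∖⁻ {Y} p) , ∈-++⁺ˡ q)) ]′ (∈-++⁻ X p)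
    ; closed = closed-∪
    ; Q = Q * r'.Q * Zs F' S' [] (Y ∩ X)
    ; a≈ = a-eq
    ; b≈ = b-eq }
    where
    open Rep r renaming (X-unique to uX)
    module r' = Rep r'
    Y = r'.X
    uY = r'.X-unique
    S' = S ++ u ∷ []
    F = E ⟍ S
    F' = E ⟍ S'
    u∈X = K⊆X (here refl)

    Y⊆ : Y ⊆ X ++ Y ∖ X
    Y⊆ {x} p with x ∈? X
    ... | yes q = ∈-++⁺ˡ q
    ... | no q  = ∈-++⁺ʳ X (∈∖⁺ p q)

    S'⁻ : ∀ {x} → x ∈ S' → x ∈ S ⊎ x ≡ u
    S'⁻ p with ∈-++⁻ S p
    ... | inj₁ q = inj₁ q
    ... | inj₂ (here q) = inj₂ q

    u∈S' : u ∈ S'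
    u∈S' = ∈-++⁺ʳ S (here refl)

    u∉Y : u ∉ Y
    u∉Y p = r'.X#S (p , u∈S')

    closed-∪ : Closed E S (X ++ Y ∖ X)
    closed-∪ {e} e∈E with closed e∈E
    ... | inj₁ cov = inj₁ (cov-++ˡ cov)
    ... | inj₂ e#X with r'.closed e∈E
    ...   | inj₁ cov = inj₁ λ x∈e →
            [ [ inj₁ , (λ { refl → contradiction (x∈e , u∈X) e#X }) ]′ ∘ S'⁻ , inj₂ ∘ Y⊆ ]′ (cov x∈e)
    ...   | inj₂ e#Y = inj₂ λ (x∈e , p) →
            [ (λ p → e#X (x∈e , p)) , (λ p → e#Y (x∈e , proj₁ (∈∖⁻ {Y} p))) ]′ (∈-++⁻ X p)

    F'⊆F : ∀ {e} → e ∈ F' → e ∈ F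
    F'⊆F e∈ = let e∈E , ⊈ = ∈⟍⁻ {E} e∈ in ∈⟍⁺ e∈E λ e⊆S → ⊈ (∈-++⁺ˡ ∘ e⊆S)

    covS' : ∀ {e U} → Cov e S U → Cov e S' U
    covS' cov x∈ = Sum.map₁ ∈-++⁺ˡ (cov x∈)

    split-Y : Zs F' S' [] Y ≈ Zs F' S' [] (Y ∩ X) * Zs F' S' [] (Y ∖ X)
    split-Y = Zs-closed-split closed-F' uY (Unique.filter⁺ _ uY) (Unique.filter⁺ _ uY)
      (proj₂ ∘ ∈∩⁻ {Y}) (λ (p , q) → ∖-disjoint X Y (q , p)) (∩-∖-sameSet Y X)
      where
      closed-F' : Closed F' S' X
      closed-F' e∈ with closed (proj₁ (∈⟍⁻ {E} e∈))
      ... | inj₁ cov = inj₁ (covS' cov)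
      ... | inj₂ e#X = inj₂ e#X

    -- Off `X` it makes no difference whether `u` is forced: an edge not inside `S ∪ X` misses `X`
    -- by closedness, and `u` lies in `X`.
    split-XY : Zs F S [] (X ++ Y ∖ X) ≈ Zs F S [] X * Zs F' S' [] (Y ∖ X)
    split-XY = Zs-++ {F} {S} {[]} {F} {S} {[]} {F'} {S'} {[]} λ {U₁} p q → mk⇔ (to {U₁} p q) (from p q)
      where
      to : ∀ {U₁ U₂} → U₁ ⊆ X → U₂ ⊆ Y ∖ X →
           Feasible F S [] (U₁ ++ U₂) → Feasible F S [] U₁ × Feasible F' S' [] U₂
      to {U₁} {U₂} p q (ind , _) = ((λ e∈ cov → ind e∈ (cov-++ˡ cov)) , λ ()) , (ind₂ , λ ())
        where
        ind₂ : ∀ {e} → e ∈ F' → ¬ Cov e S' U₂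
        ind₂ e∈ cov with closed (proj₁ (∈⟍⁻ {E} e∈))
        ... | inj₁ cX = proj₂ (∈⟍⁻ {E} e∈) λ x∈e →
                [ id , (λ x∈U₂ →
                  [ ∈-++⁺ˡ , (λ x∈X → contradiction x∈X (proj₂ (∈∖⁻ {Y} (q x∈U₂)))) ]′ (cX x∈e)) ]′ (cov x∈e)
        ... | inj₂ e#X = ind (F'⊆F e∈) (cov-++ʳ U₁ λ x∈e →
                [ [ inj₁ , (λ { refl → contradiction (x∈e , u∈X) e#X }) ]′ ∘ S'⁻ , inj₂ ]′ (cov x∈e))
      from : ∀ {U₁ U₂} → U₁ ⊆ X → U₂ ⊆ Y ∖ X →
             Feasible F S [] U₁ × Feasible F' S' [] U₂ → Feasible F S [] (U₁ ++ U₂)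
      from {U₁} {U₂} p q ((ind₁ , _) , (ind₂ , _)) = ind , λ ()
        where
        ind : ∀ {e} → e ∈ F → ¬ Cov e S (U₁ ++ U₂)
        ind {e} e∈ cov with closed (proj₁ (∈⟍⁻ {E} e∈))
        ... | inj₁ cX = ind₁ e∈ (cov-dropʳ U₁ cov λ x∈e x∈U₂ →
                [ id , (λ x∈X → contradiction x∈X (proj₂ (∈∖⁻ {Y} (q x∈U₂)))) ]′ (cX x∈e))
        ... | inj₂ e#X = ind₂ (∈⟍⁺ (proj₁ (∈⟍⁻ {E} e∈)) ⊈S')
                (covS' (cov-dropˡ U₁ cov λ x∈e x∈U₁ → contradiction (x∈e , p x∈U₁) e#X))
          where
          ⊈S' : ¬ (e ⊆ S')
          ⊈S' e⊆ = proj₂ (∈⟍⁻ {E} e∈) λ x∈e →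
            [ id , (λ { refl → contradiction (x∈e , u∈X) e#X }) ]′ (S'⁻ (e⊆ x∈e))

    -- `Y` is closed relative to `S'`, so cutting along it is possible because `u` is required on
    -- the other side, in `X ∖ Y`. It serves twice: `Z = Y ∩ X` with no requirement, and `Z = Y`
    -- with `os`.
    split-u : ∀ {K W Z} → Unique W → Unique Z → Z ⊆ Y → K ⊆ Z → Disjoint (X ∖ Y) Z →
      SameSet W (X ∖ Y ++ Z) →
      Zs F S (u ∷ K) W ≈ Zs F S (u ∷ []) (X ∖ Y) * Zs F' S' K Z
    split-u {K} {W} {Z} uW uZ Z⊆Y K⊆Z disj same =
      Zs-split {F} {S} {u ∷ K} {F} {S} {u ∷ []} {F'} {S'} {K} uW
        (Unique.filter⁺ _ uX) uZ disj same λ {U₁} {U₂} p q → mk⇔ (to {U₁} {U₂} p q) (from p q)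
      where
      to : ∀ {U₁ U₂} → U₁ ⊆ X ∖ Y → U₂ ⊆ Z →
           Feasible F S (u ∷ K) (U₁ ++ U₂) → Feasible F S (u ∷ []) U₁ × Feasible F' S' K U₂
      to {U₁} {U₂} p q (ind , K⊆) =
        ((λ e∈ cov → ind e∈ (cov-++ˡ cov)) , λ { (here refl) → u∈U₁ }) , (ind₂ , K⊆U₂)
        where
        u∈U₁ : u ∈ U₁
        u∈U₁ = [ id , (λ u∈U₂ → contradiction (Z⊆Y (q u∈U₂)) u∉Y) ]′ (∈-++⁻ U₁ (K⊆ (here refl)))
        K⊆U₂ : K ⊆ U₂
        K⊆U₂ x∈K = [ (λ x∈U₁ → contradiction (p x∈U₁ , K⊆Z x∈K) disj) , id ]′ (∈-++⁻ U₁ (K⊆ (there x∈K)))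
        ind₂ : ∀ {e} → e ∈ F' → ¬ Cov e S' U₂
        ind₂ e∈ cov = ind (F'⊆F e∈) λ x∈e →
          [ [ inj₁ , (λ { refl → inj₂ (∈-++⁺ˡ u∈U₁) }) ]′ ∘ S'⁻ , inj₂ ∘ ∈-++⁺ʳ U₁ ]′ (cov x∈e)
      from : ∀ {U₁ U₂} → U₁ ⊆ X ∖ Y → U₂ ⊆ Z →
             Feasible F S (u ∷ []) U₁ × Feasible F' S' K U₂ → Feasible F S (u ∷ K) (U₁ ++ U₂)
      from {U₁} {U₂} p q ((ind₁ , u⊆) , (ind₂ , K⊆)) =
        ind , λ { (here refl) → ∈-++⁺ˡ (u⊆ (here refl)) ; (there x∈K) → ∈-++⁺ʳ U₁ (K⊆ x∈K) }
        where
        ind : ∀ {e} → e ∈ F → ¬ Cov e S (U₁ ++ U₂)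
        ind {e} e∈ cov with r'.closed (proj₁ (∈⟍⁻ {E} e∈))
        ... | inj₂ e#Y = ind₁ e∈ (cov-dropʳ U₁ cov λ x∈e x∈U₂ → contradiction (x∈e , Z⊆Y (q x∈U₂)) e#Y)
        ... | inj₁ cY with e ⊆ₗ? S'
        -- An edge completed by `u` is missing from `F'`. Since `u` is required in the first factor,
        -- that factor already excludes it.
        ...   | yes e⊆S' = ind₁ e∈ λ x∈e → Sum.map₂ (λ { refl → u⊆ (here refl) }) (S'⁻ (e⊆S' x∈e))
        ...   | no e⊈S' = ind₂ (∈⟍⁺ (proj₁ (∈⟍⁻ {E} e∈)) e⊈S') (cov-dropˡ U₁ (covS' cov) λ x∈e x∈U₁ →
                [ id , (λ x∈Y → contradiction x∈Y (proj₂ (∈∖⁻ {X} (p x∈U₁)))) ]′ (cY x∈e))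

    split-uX : Zs F S (u ∷ []) X ≈ Zs F S (u ∷ []) (X ∖ Y) * Zs F' S' [] (Y ∩ X)
    split-uX = split-u uX (Unique.filter⁺ _ uY) (proj₁ ∘ ∈∩⁻ {Y}) (λ ())
      (λ (p , q) → proj₂ (∈∖⁻ {X} p) (proj₁ (∈∩⁻ {Y} q))) (to , from)
      where
      to : X ⊆ X ∖ Y ++ Y ∩ X
      to {x} p with x ∈? Y
      ... | yes q = ∈-++⁺ʳ (X ∖ Y) (∈∩⁺ q p)
      ... | no q  = ∈-++⁺ˡ (∈∖⁺ p q)
      from : X ∖ Y ++ Y ∩ X ⊆ X
      from = [ proj₁ ∘ ∈∖⁻ {X} , proj₂ ∘ ∈∩⁻ {Y} ]′ ∘ ∈-++⁻ (X ∖ Y)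

    split-uXY : Zs F S (u ∷ os) (X ++ Y ∖ X) ≈ Zs F S (u ∷ []) (X ∖ Y) * Zs F' S' os Y
    split-uXY = split-u (Unique.++⁺ uX (Unique.filter⁺ _ uY) (∖-disjoint X Y)) uY id r'.K⊆X
      (λ (p , q) → proj₂ (∈∖⁻ {X} p) q) (to , from)
      where
      to : X ++ Y ∖ X ⊆ X ∖ Y ++ Y
      to {x} p with x ∈? Y
      ... | yes q = ∈-++⁺ʳ (X ∖ Y) q
      ... | no q with ∈-++⁻ X p
      ...   | inj₁ p₁ = ∈-++⁺ˡ (∈∖⁺ p₁ q)
      ...   | inj₂ p₂ = contradiction (proj₁ (∈∖⁻ {Y} p₂)) q
      from : X ∖ Y ++ Y ⊆ X ++ Y ∖ X
      from = [ ∈-++⁺ˡ ∘ proj₁ ∘ ∈∖⁻ {X} , Y⊆ ]′ ∘ ∈-++⁻ (X ∖ Y)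

    a-eq : a * a' ≈ Q * r'.Q * Zs F' S' [] (Y ∩ X) * Zs F S [] (X ++ Y ∖ X)
    a-eq = begin
      a * a' ≈⟨ *-cong a≈ (≈-trans r'.a≈ (*-congˡ split-Y)) ⟩
      Q * Zs F S [] X * (r'.Q * (Zs F' S' [] (Y ∩ X) * Zs F' S' [] (Y ∖ X)))
        ≈⟨ solve 5 (λ q z q' z₁ z₂ → (q ⊕ z) ⊕ (q' ⊕ (z₁ ⊕ z₂)) ⊜ ((q ⊕ q') ⊕ z₁) ⊕ (z ⊕ z₂)) ≈-refl
             Q (Zs F S [] X) r'.Q (Zs F' S' [] (Y ∩ X)) (Zs F' S' [] (Y ∖ X)) ⟩
      Q * r'.Q * Zs F' S' [] (Y ∩ X) * (Zs F S [] X * Zs F' S' [] (Y ∖ X))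
        ≈⟨ *-congˡ split-XY ⟨
      Q * r'.Q * Zs F' S' [] (Y ∩ X) * Zs F S [] (X ++ Y ∖ X) ∎

    b-eq : b * b' ≈ Q * r'.Q * Zs F' S' [] (Y ∩ X) * Zs F S (u ∷ os) (X ++ Y ∖ X)
    b-eq = begin
      b * b' ≈⟨ *-cong (≈-trans b≈ (*-congˡ split-uX)) r'.b≈ ⟩
      Q * (Zs F S (u ∷ []) (X ∖ Y) * Zs F' S' [] (Y ∩ X)) * (r'.Q * Zs F' S' os Y)
        ≈⟨ solve 5 (λ q z z₁ q' z₂ → (q ⊕ (z ⊕ z₁)) ⊕ (q' ⊕ z₂) ⊜ ((q ⊕ q') ⊕ z₁) ⊕ (z ⊕ z₂)) ≈-refl
             Q (Zs F S (u ∷ []) (X ∖ Y)) (Zs F' S' [] (Y ∩ X)) r'.Q (Zs F' S' os Y) ⟩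
      Q * r'.Q * Zs F' S' [] (Y ∩ X) * (Zs F S (u ∷ []) (X ∖ Y) * Zs F' S' os Y)
        ≈⟨ *-congˡ split-uXY ⟨
      Q * r'.Q * Zs F' S' [] (Y ∩ X) * Zs F S (u ∷ os) (X ++ Y ∖ X) ∎
  Rep-resp : ∀ {V E E' S K a b} → SameSet E E' → Rep V E S K a b → Rep V E' S K a b
  Rep-resp {V} {E} {E'} {S} {K} (E⊆ , ⊆E) r = record
    { Rep r ; closed = Rep.closed r ∘ ⊆E
    ; a≈ = ≈-trans (Rep.a≈ r) (*-congˡ (eq []))
    ; b≈ = ≈-trans (Rep.b≈ r) (*-congˡ (eq K)) }
    where
    mono : ∀ {E₁ E₂ : List (List A)} {e} → E₁ ⊆ E₂ → e ∈ E₁ ⟍ S → e ∈ E₂ ⟍ S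
    mono {E₁} sub e∈ = let p , q = ∈⟍⁻ {E₁} e∈ in ∈⟍⁺ (sub p) q
    eq : ∀ K → Zs (E ⟍ S) S K (Rep.X r) ≈ Zs (E' ⟍ S) S K (Rep.X r)
    eq K = Zs-cong {E ⟍ S} {S} {K} {E' ⟍ S} {S} {K} {Rep.X r} λ _ → mk⇔
      (λ (ind , p) → (λ e∈ cov → ind (mono {E'} {E} ⊆E e∈) cov) , p)
      (λ (ind , p) → (λ e∈ cov → ind (mono {E} {E'} E⊆ e∈) cov) , p)

  -- Translates a residual hypergraph with nothing forced into the original edges with `S` forced.
  -- Residuals are matched only as sets because `⊖` merges edges with equal residual; edges that
  -- miss `V'` belong to other components.
  Rep-residual : ∀ {V E S V' E' K a b} → V' ⊆ V → Disjoint V' S →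
    (∀ {e} → e ∈ E → ¬ (e ⊆ S) → (∃[ f ] f ∈ E' × SameSet f (e ∖ S)) ⊎ Disjoint e V') →
    (∀ {f} → f ∈ E' → ∃[ e ] e ∈ E × ¬ (e ⊆ S) × SameSet f (e ∖ S)) →
    Rep V' E' [] K a b → Rep V E S K a b
  Rep-residual {V} {E} {S} {V'} {E'} {K} V'⊆V V'#S down up r = record
    { X = X ; X-unique = X-unique ; X⊆V = V'⊆V ∘ X⊆V ; K⊆X = K⊆X
    ; X#S = λ (p , q) → V'#S (X⊆V p , q)
    ; closed = closed'
    ; Q = Q ; a≈ = ≈-trans a≈ (*-congˡ (eq [])) ; b≈ = ≈-trans b≈ (*-congˡ (eq K)) }
    where
    open Rep r hiding (X#S)
    cover : ∀ {e f U} → SameSet f (e ∖ S) → Cov f [] U → Cov e S U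
    cover {e} (_ , ⊆f) cov {x} x∈e with x ∈? S
    ... | yes x∈S = inj₁ x∈S
    ... | no x∉S  = inj₂ ([ (λ ()) , id ]′ (cov (⊆f (∈∖⁺ x∈e x∉S))))
    uncover : ∀ {e f U} → SameSet f (e ∖ S) → Cov e S U → Cov f [] U
    uncover {e} (f⊆ , _) cov x∈f = let x∈e , x∉S = ∈∖⁻ {e} (f⊆ x∈f) in
      inj₂ ([ (λ x∈S → contradiction x∈S x∉S) , id ]′ (cov x∈e))
    closed' : Closed E S X
    closed' {e} e∈E with e ⊆ₗ? S
    ... | yes e⊆S = inj₁ (inj₁ ∘ e⊆S)
    ... | no e⊈S with down e∈E e⊈S
    ...   | inj₂ e#V' = inj₂ λ (p , q) → e#V' (p , X⊆V q)
    ...   | inj₁ (f , f∈ , same) with closed f∈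
    ...     | inj₁ cov = inj₁ (cover same cov)
    ...     | inj₂ f#X = inj₂ λ (p , q) → f#X (proj₂ same (∈∖⁺ p λ s → V'#S (X⊆V q , s)) , q)
    eq : ∀ K → Zs (E' ⟍ []) [] K X ≈ Zs (E ⟍ S) S K X
    eq K = Zs-cong λ U⊆X → mk⇔
      (λ (ind , p) → (λ e∈ cov → to ind U⊆X (proj₁ (∈⟍⁻ {E} e∈)) (proj₂ (∈⟍⁻ {E} e∈)) cov) , p)
      (λ (ind , p) → (λ f∈ cov → from ind (proj₁ (∈⟍⁻ {E'} f∈)) cov) , p)
      where
      to : ∀ {U e} → (∀ {f} → f ∈ E' ⟍ [] → ¬ Cov f [] U) → U ⊆ X → e ∈ E → ¬ (e ⊆ S) → ¬ Cov e S U
      to ind U⊆X e∈E e⊈S cov with down e∈E e⊈S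
      ... | inj₂ e#V' = e⊈S λ x∈e → [ id , (λ x∈U → contradiction (x∈e , X⊆V (U⊆X x∈U)) e#V') ]′ (cov x∈e)
      ... | inj₁ (f , f∈ , same) = ind
        (∈⟍⁺ f∈ λ f⊆[] → e⊈S λ x∈e → [ id , (λ ()) ]′ (cover {U = []} same (inj₁ ∘ f⊆[]) x∈e))
        (uncover same cov)
      from : ∀ {U f} → (∀ {e} → e ∈ E ⟍ S → ¬ Cov e S U) → f ∈ E' → ¬ Cov f [] U
      from ind f∈ cov with up f∈
      ... | e , e∈E , e⊈S , same = ind (∈⟍⁺ e∈E e⊈S) (cover same cov)

  -- E₀ are the edges avoiding v and es the edges at v not yet removed.
  record RootRep (V : List A) (E₀ es : List (List A)) (v : A) (a b : Carrier) : Set where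
    field
      X        : List A
      X-unique : Unique X
      X⊆V      : X ⊆ V
      v∉X      : v ∉ X
      es-cov   : ∀ {e} → e ∈ es → Cov e (v ∷ []) X
      closed   : Closed (es ++ E₀) (v ∷ []) X
      Q        : Carrier
      a≈       : a ≈ Q * Zs E₀ (v ∷ []) [] X
      b≈       : b ≈ Q * Zs (es ++ E₀) (v ∷ []) [] X

  RootRep-empty : ∀ {V E₀ v} → (∀ {e} → e ∈ E₀ → ¬ (e ⊆ v ∷ [])) → RootRep V E₀ [] v 1# 1#
  RootRep-empty {E₀ = E₀} {v} ⊈v = record
    { X = [] ; X-unique = [] ; X⊆V = λ () ; v∉X = λ () ; es-cov = λ () ; closed = λ _ → inj₂ λ ()
    ; Q = 1# ; a≈ = one ; b≈ = one }
    where
    feasible : Feasible E₀ (v ∷ []) [] []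
    feasible = (λ e∈ cov → ⊈v e∈ ([ id , (λ ()) ]′ ∘ cov)) , λ ()
    one : 1# ≈ 1# * Zs E₀ (v ∷ []) [] []
    one = ≈-sym (≈-trans (*-identityˡ _)
            (ι-cong (feasible? E₀ (v ∷ []) [] []) (yes feasible) (mk⇔ id id)))

  -- With `S` forced, `e` is violated exactly when all of `os` is chosen.
  Zs-∷ : ∀ E S e os X → SameSet e (S ++ os) → Disjoint os S →
         Zs E S [] X ≈ Zs (e ∷ E) S [] X + Zs E S os X
  Zs-∷ E S e os X (e⊆ , ⊆e) os#S = ≈-trans (Sum-cong X λ {U} _ → indicator U)
    (Sum-+ X (λ U → ι (feasible? (e ∷ E) S [] U)) (λ U → ι (feasible? E S os U)))
    where
    indicator : ∀ U → ι (feasible? E S [] U) ≈ ι (feasible? (e ∷ E) S [] U) + ι (feasible? E S os U)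
    indicator U with os ⊆ₗ? U
    ... | yes os⊆U = ≈-sym (≈-trans
      (+-cong (ι-cong (feasible? (e ∷ E) S [] U) (no λ (ind , _) → ind (here refl) cov) (mk⇔ id id))
              (ι-cong (feasible? E S os U) (feasible? E S [] U)
                (mk⇔ (λ (ind , _) → ind , λ ()) (λ (ind , _) → ind , os⊆U))))
      (+-identityˡ _))
      where
      cov : Cov e S U
      cov x∈e = Sum.map₂ os⊆U (∈-++⁻ S (e⊆ x∈e))
    ... | no os⊈U = ≈-sym (≈-trans
      (+-cong (ι-cong (feasible? (e ∷ E) S [] U) (feasible? E S [] U) (mk⇔ to from))
              (ι-cong (feasible? E S os U) (no λ (_ , p) → os⊈U p) (mk⇔ id id)))
      (+-identityʳ _))
      where
      os⊆U : Cov e S U → os ⊆ U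
      os⊆U cov x∈os = [ (λ x∈S → contradiction (x∈os , x∈S) os#S) , id ]′ (cov (⊆e (∈-++⁺ʳ S x∈os)))
      to : Feasible (e ∷ E) S [] U → Feasible E S [] U
      to (ind , _) = (λ e∈ → ind (there e∈)) , λ ()
      from : Feasible E S [] U → Feasible (e ∷ E) S [] U
      from (ind , _) = (λ { (here refl) cov → os⊈U (os⊆U cov) ; (there e∈) cov → ind e∈ cov }) , λ ()

  -- `a` and `a - b` are one and the same multiple of the partition function on `Y` without and with
  -- `e`, the edges `es` being present in both; `A` and `B` compare none of `es` with all of `es`.
  -- Multiplying telescopes from no edge at `v` to all of `e ∷ es`. The doubled overlap is cut off
  -- `Y` in `a * A` and off `X` in `(a - b) * B`.
  RootRep-step : ∀ {V E₀ es v e os a b A B} →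
    (∀ {f} → f ∈ E₀ → ¬ (f ⊆ v ∷ [])) → SameSet e (v ∷ os) →
    Rep V (es ++ E₀) (v ∷ []) os a b → RootRep V E₀ es v A B →
    RootRep V E₀ (e ∷ es) v (a * A) ((a - b) * B)
  RootRep-step {V} {E₀} {es} {v} {e} {os} {a} {b} {A} {B} E₀⊈ e~ r r' = record
    { X = Y ++ X ∖ Y
    ; X-unique = uXY
    ; X⊆V = [ r.X⊆V , X⊆V ∘ proj₁ ∘ ∈∖⁻ {X} ]′ ∘ ∈-++⁻ Y
    ; v∉X = [ v∉Y , v∉X ∘ proj₁ ∘ ∈∖⁻ {X} ]′ ∘ ∈-++⁻ Y
    ; es-cov = λ { (here refl) → cov-++ˡ e-cov ; (there p) x∈ → Sum.map₂ X⊆ (es-cov p x∈) }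
    ; closed = λ { (here refl) → inj₁ (cov-++ˡ e-cov) ; (there p) → closed-∪ p }
    ; Q = r.Q * Q * Zs F T [] (X ∩ Y)
    ; a≈ = a-eq
    ; b≈ = b-eq }
    where
    open RootRep r' renaming (X-unique to uX)
    module r = Rep r
    Y = r.X
    uY = r.X-unique
    E₁ = es ++ E₀
    T = v ∷ []
    F = E₁ ⟍ T

    v∉Y : v ∉ Y
    v∉Y p = r.X#S (p , here refl)

    uXY : Unique (Y ++ X ∖ Y)
    uXY = Unique.++⁺ uY (Unique.filter⁺ _ uX) (∖-disjoint Y X)

    X⊆ : X ⊆ Y ++ X ∖ Y
    X⊆ {x} p with x ∈? Y
    ... | yes q = ∈-++⁺ˡ q
    ... | no q  = ∈-++⁺ʳ Y (∈∖⁺ p q)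

    e-cov : Cov e T Y
    e-cov x∈e with proj₁ e~ x∈e
    ... | here p  = inj₁ (here p)
    ... | there p = inj₂ (r.K⊆X p)

    closed-∪ : Closed E₁ T (Y ++ X ∖ Y)
    closed-∪ e∈ with closed e∈ | r.closed e∈
    ... | inj₁ cov | _        = inj₁ λ x∈ → Sum.map₂ X⊆ (cov x∈)
    ... | inj₂ _   | inj₁ cov = inj₁ (cov-++ˡ cov)
    ... | inj₂ e#X | inj₂ e#Y = inj₂ λ (x∈e , p) →
      [ (λ p → e#Y (x∈e , p)) , (λ p → e#X (x∈e , proj₁ (∈∖⁻ {X} p))) ]′ (∈-++⁻ Y p)

    closed-F : Closed F T X
    closed-F e∈ = closed (proj₁ (∈⟍⁻ {E₁} e∈))

    -- The edges `es` lie in `{v} ∪ X` by `es-cov`, so on `Y ∖ X` only `E₀` acts. This exchanges the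
    -- `F` carried by `a` for the `E₀` that the result needs.
    split-Y : Zs F T [] Y ≈ Zs F T [] (X ∩ Y) * Zs E₀ T [] (Y ∖ X)
    split-Y = ≈-trans
      (Zs-closed-split closed-F uY (Unique.filter⁺ _ uX) (Unique.filter⁺ _ uY)
        (proj₁ ∘ ∈∩⁻ {X}) (λ (p , q) → ∖-disjoint X Y (q , p)) (to , from))
      (*-congˡ (Zs-cong λ q → mk⇔ (λ (ind , _) → (λ e∈ cov → ind (E₀⊆F e∈) cov) , λ ())
                                    (λ (ind , _) → (λ e∈ cov → restrict q ind e∈ cov) , λ ())))
      where
      E₀⊆F : ∀ {e} → e ∈ E₀ → e ∈ F
      E₀⊆F e∈ = ∈⟍⁺ (∈-++⁺ʳ es e∈) (E₀⊈ e∈)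
      restrict : ∀ {U e} → U ⊆ Y ∖ X → (∀ {e} → e ∈ E₀ → ¬ Cov e T U) → e ∈ F → ¬ Cov e T U
      restrict q ind e∈ cov with ∈-++⁻ es (proj₁ (∈⟍⁻ {E₁} e∈))
      ... | inj₂ e∈E₀ = ind e∈E₀ cov
      ... | inj₁ e∈es = proj₂ (∈⟍⁻ {E₁} e∈) λ x∈e → [ id , (λ x∈U →
              [ id , (λ x∈X → contradiction x∈X (proj₂ (∈∖⁻ {Y} (q x∈U)))) ]′ (es-cov e∈es x∈e)) ]′ (cov x∈e)
      to : Y ⊆ X ∩ Y ++ Y ∖ X
      to {x} p with x ∈? X
      ... | yes q = ∈-++⁺ˡ (∈∩⁺ q p)
      ... | no q  = ∈-++⁺ʳ (X ∩ Y) (∈∖⁺ p q)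
      from : X ∩ Y ++ Y ∖ X ⊆ Y
      from = [ proj₂ ∘ ∈∩⁻ {X} , proj₁ ∘ ∈∖⁻ {Y} ]′ ∘ ∈-++⁻ (X ∩ Y)

    split-E₀ : Zs E₀ T [] (Y ++ X ∖ Y) ≈ Zs E₀ T [] X * Zs E₀ T [] (Y ∖ X)
    split-E₀ = Zs-closed-split (closed ∘ ∈-++⁺ʳ es) uXY uX (Unique.filter⁺ _ uY)
      id (λ (p , q) → ∖-disjoint X Y (q , p)) (to , from)
      where
      to : Y ++ X ∖ Y ⊆ X ++ Y ∖ X
      to {x} p with x ∈? X
      ... | yes q = ∈-++⁺ˡ q
      ... | no q with ∈-++⁻ Y p
      ...   | inj₁ p₁ = ∈-++⁺ʳ X (∈∖⁺ p₁ q)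
      ...   | inj₂ p₂ = contradiction (proj₁ (∈∖⁻ {X} p₂)) q
      from : X ++ Y ∖ X ⊆ Y ++ X ∖ Y
      from = [ X⊆ , ∈-++⁺ˡ ∘ proj₁ ∘ ∈∖⁻ {Y} ]′ ∘ ∈-++⁻ X

    -- `D` is empty for `split-X` and holds `e` for `split-e`. An edge {v} in `E₁` makes the left
    -- side vanish; the first factor has dropped it through `F`, so the factor on `X ∖ Y` keeps it.
    split-D : ∀ {D W W₁} → (∀ {f} → f ∈ D → Cov f T Y) → Unique W → Unique W₁ →
      W₁ ⊆ Y → SameSet W (W₁ ++ X ∖ Y) →
      Zs (D ++ E₁) T [] W ≈ Zs (D ++ F) T [] W₁ * Zs E₁ T [] (X ∖ Y)
    split-D {D} {W} {W₁} D-cov uW uW₁ W₁⊆Y same =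
      Zs-split {D ++ E₁} {T} {[]} {D ++ F} {T} {[]} {E₁} {T} {[]}
        uW uW₁ (Unique.filter⁺ _ uX) (λ (p , q) → ∖-disjoint Y X (W₁⊆Y p , q)) same
        λ {U₁} p q → mk⇔ (to {U₁}) (from p q)
      where
      to : ∀ {U₁ U₂} → Feasible (D ++ E₁) T [] (U₁ ++ U₂) →
           Feasible (D ++ F) T [] U₁ × Feasible E₁ T [] U₂
      to {U₁} (ind , _) =
        ((λ f∈ cov → ind ([ ∈-++⁺ˡ , ∈-++⁺ʳ D ∘ proj₁ ∘ ∈⟍⁻ {E₁} ]′ (∈-++⁻ D f∈)) (cov-++ˡ cov)) , λ ()) ,
        ((λ f∈ cov → ind (∈-++⁺ʳ D f∈) (cov-++ʳ U₁ cov)) , λ ())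
      from : ∀ {U₁ U₂} → U₁ ⊆ W₁ → U₂ ⊆ X ∖ Y →
             Feasible (D ++ F) T [] U₁ × Feasible E₁ T [] U₂ → Feasible (D ++ E₁) T [] (U₁ ++ U₂)
      from {U₁} {U₂} p q ((ind₁ , _) , (ind₂ , _)) = (λ f∈ → [ ind-D , ind-E ]′ (∈-++⁻ D f∈)) , λ ()
        where
        restrict : ∀ {f} → Cov f T Y → Cov f T (U₁ ++ U₂) → Cov f T U₁
        restrict cY cov = cov-dropʳ U₁ cov λ x∈f x∈U₂ →
          [ id , (λ x∈Y → contradiction x∈Y (proj₂ (∈∖⁻ {X} (q x∈U₂)))) ]′ (cY x∈f)
        ind-D : ∀ {f} → f ∈ D → ¬ Cov f T (U₁ ++ U₂)
        ind-D f∈ cov = ind₁ (∈-++⁺ˡ f∈) (restrict (D-cov f∈) cov)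
        ind-E : ∀ {f} → f ∈ E₁ → ¬ Cov f T (U₁ ++ U₂)
        ind-E {f} f∈ cov with r.closed f∈ | f ⊆ₗ? T
        ... | inj₂ f#Y | _ = ind₂ f∈ (cov-dropˡ U₁ cov λ x∈f x∈U₁ → contradiction (x∈f , W₁⊆Y (p x∈U₁)) f#Y)
        ... | inj₁ cY  | yes f⊆T = ind₂ f∈ (inj₁ ∘ f⊆T)
        ... | inj₁ cY  | no f⊈T  = ind₁ (∈-++⁺ʳ D (∈⟍⁺ f∈ f⊈T)) (restrict cY cov)

    split-X : Zs E₁ T [] X ≈ Zs F T [] (X ∩ Y) * Zs E₁ T [] (X ∖ Y)
    split-X = split-D {[]} (λ ()) uX (Unique.filter⁺ _ uX) (proj₂ ∘ ∈∩⁻ {X}) (∩-∖-sameSet X Y)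

    split-e : Zs (e ∷ E₁) T [] (Y ++ X ∖ Y) ≈ Zs (e ∷ F) T [] Y * Zs E₁ T [] (X ∖ Y)
    split-e = split-D {e ∷ []} (λ { (here refl) → e-cov }) uXY uY id (id , id)

    difference : a - b ≈ r.Q * Zs (e ∷ F) T [] Y
    difference = begin
      a - b             ≈⟨ +-cong r.a≈ (-‿cong r.b≈) ⟩
      r.Q * Zs F T [] Y - r.Q * Zs F T os Y
        ≈⟨ +-congʳ (*-congˡ (Zs-∷ F T e os Y e~ λ { (p , here refl) → v∉Y (r.K⊆X p) })) ⟩
      r.Q * (Zs (e ∷ F) T [] Y + Zs F T os Y) - r.Q * Zs F T os Y
        ≈⟨ +-congʳ (distribˡ _ _ _) ⟩
      r.Q * Zs (e ∷ F) T [] Y + r.Q * Zs F T os Y - r.Q * Zs F T os Y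
        ≈⟨ ≈-trans (+-assoc _ _ _) (≈-trans (+-congˡ (-‿inverseʳ _)) (+-identityʳ _)) ⟩
      r.Q * Zs (e ∷ F) T [] Y ∎

    a-eq : a * A ≈ r.Q * Q * Zs F T [] (X ∩ Y) * Zs E₀ T [] (Y ++ X ∖ Y)
    a-eq = begin
      a * A ≈⟨ *-cong (≈-trans r.a≈ (*-congˡ split-Y)) a≈ ⟩
      r.Q * (Zs F T [] (X ∩ Y) * Zs E₀ T [] (Y ∖ X)) * (Q * Zs E₀ T [] X)
        ≈⟨ solve 5 (λ q z z₁ q' z₂ → (q ⊕ (z ⊕ z₁)) ⊕ (q' ⊕ z₂) ⊜ ((q ⊕ q') ⊕ z) ⊕ (z₂ ⊕ z₁)) ≈-refl
             r.Q (Zs F T [] (X ∩ Y)) (Zs E₀ T [] (Y ∖ X)) Q (Zs E₀ T [] X) ⟩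
      r.Q * Q * Zs F T [] (X ∩ Y) * (Zs E₀ T [] X * Zs E₀ T [] (Y ∖ X)) ≈⟨ *-congˡ split-E₀ ⟨
      r.Q * Q * Zs F T [] (X ∩ Y) * Zs E₀ T [] (Y ++ X ∖ Y) ∎

    b-eq : (a - b) * B ≈ r.Q * Q * Zs F T [] (X ∩ Y) * Zs (e ∷ E₁) T [] (Y ++ X ∖ Y)
    b-eq = begin
      (a - b) * B ≈⟨ *-cong difference (≈-trans b≈ (*-congˡ split-X)) ⟩
      r.Q * Zs (e ∷ F) T [] Y * (Q * (Zs F T [] (X ∩ Y) * Zs E₁ T [] (X ∖ Y)))
        ≈⟨ solve 5 (λ q z q' z₁ z₂ → (q ⊕ z) ⊕ (q' ⊕ (z₁ ⊕ z₂)) ⊜ ((q ⊕ q') ⊕ z₁) ⊕ (z ⊕ z₂)) ≈-refl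
             r.Q (Zs (e ∷ F) T [] Y) Q (Zs F T [] (X ∩ Y)) (Zs E₁ T [] (X ∖ Y)) ⟩
      r.Q * Q * Zs F T [] (X ∩ Y) * (Zs (e ∷ F) T [] Y * Zs E₁ T [] (X ∖ Y)) ≈⟨ *-congˡ split-e ⟨
      r.Q * Q * Zs F T [] (X ∩ Y) * Zs (e ∷ E₁) T [] (Y ++ X ∖ Y) ∎

  -- The weight of v enters only here: U ∌ v contributes a, v ∷ U contributes w v * b.
  RootRep⇒Rep : ∀ {V E E₀ es v a b} → v ∈ V → SameSet E (es ++ E₀) →
    (∀ {e} → e ∈ E → ¬ (e ⊆ [])) → (∀ {e} → e ∈ es → v ∈ e) → (∀ {e} → e ∈ E₀ → v ∉ e) →
    RootRep V E₀ es v a b → Rep V E [] (v ∷ []) (w v * b + a) (w v * b)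
  RootRep⇒Rep {V} {E} {E₀} {es} {v} {a} {b} v∈V (E⊆ , ⊆E) E⊈ es∋v E₀∌v r = record
    { X = v ∷ X
    ; X-unique = All.tabulate (λ { p refl → v∉X p }) ∷ X-unique
    ; X⊆V = λ { (here refl) → v∈V ; (there p) → X⊆V p }
    ; K⊆X = λ { (here refl) → here refl }
    ; X#S = λ ()
    ; closed = closed' ∘ E⊆
    ; Q = Q
    ; a≈ = ≈-trans (+-cong out-in a≈) (≈-trans (≈-sym (distribˡ _ _ _))
             (*-congˡ (+-cong (*-congˡ (with-v [] λ ())) without-v)))
    ; b≈ = ≈-trans out-in (*-congˡ (≈-trans (*-congˡ (with-v (v ∷ []) λ { (here refl) → here refl }))
             (≈-sym (≈-trans (+-congˡ no-v) (+-identityʳ _))))) }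
    where
    open RootRep r
    F = E ⟍ []
    out-in : w v * b ≈ Q * (w v * Zs (es ++ E₀) (v ∷ []) [] X)
    out-in = ≈-trans (*-congˡ b≈) (solve 3 (λ x y z → x ⊕ (y ⊕ z) ⊜ y ⊕ (x ⊕ z)) ≈-refl _ _ _)

    closed' : Closed (es ++ E₀) [] (v ∷ X)
    closed' {e} e∈ with closed e∈ | ∈-++⁻ es e∈
    ... | inj₁ cov | _          = inj₁ λ x∈ → inj₂ ([ (λ { (here p) → here p }) , there ]′ (cov x∈))
    ... | inj₂ _   | inj₁ e∈es  = inj₁ λ x∈ → inj₂ ([ (λ { (here p) → here p }) , there ]′ (es-cov e∈es x∈))
    ... | inj₂ e#X | inj₂ e∈E₀  = inj₂
      λ { (x∈e , here refl) → E₀∌v e∈E₀ x∈e ; (x∈e , there p) → e#X (x∈e , p) }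

    shift : ∀ {e U} → Cov e (v ∷ []) U → Cov e [] (v ∷ U)
    shift cov x∈ = inj₂ ([ (λ { (here p) → here p }) , there ]′ (cov x∈))

    unshift : ∀ {e U} → Cov e [] (v ∷ U) → Cov e (v ∷ []) U
    unshift cov x∈ = [ (λ ()) , (λ { (here p) → inj₁ (here p) ; (there p) → inj₂ p }) ]′ (cov x∈)

    with-v : ∀ K → K ⊆ v ∷ [] → Zs (es ++ E₀) (v ∷ []) [] X ≈ Sum X (λ U → ι (feasible? F [] K (v ∷ U)))
    with-v K K⊆ = Sum-cong X λ {U} _ →
      ι-cong (feasible? (es ++ E₀) (v ∷ []) [] U) (feasible? F [] K (v ∷ U)) (mk⇔
        (λ (ind , _) → (λ e∈ cov → ind (E⊆ (proj₁ (∈⟍⁻ {E} e∈))) (unshift cov)) ,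
                       λ x∈K → ∈-++⁺ˡ (K⊆ x∈K))
        (λ (ind , _) → (λ e∈ cov → ind (∈⟍⁺ (⊆E e∈) (E⊈ (⊆E e∈))) (shift cov)) , λ ()))

    without-v : Zs E₀ (v ∷ []) [] X ≈ Zs F [] [] X
    without-v = Zs-cong λ U⊆X → mk⇔
      (λ (ind , _) → (λ e∈ cov → to U⊆X ind (E⊆ (proj₁ (∈⟍⁻ {E} e∈))) cov) , λ ())
      (λ (ind , _) → (λ e∈ cov → let e∈E = ⊆E (∈-++⁺ʳ es e∈) in ind (∈⟍⁺ e∈E (E⊈ e∈E))
        λ x∈e → inj₂ ([ (λ { (here refl) → contradiction x∈e (E₀∌v e∈) }) , id ]′ (cov x∈e))) , λ ())
      where
      to : ∀ {U e} → U ⊆ X → (∀ {e} → e ∈ E₀ → ¬ Cov e (v ∷ []) U) → e ∈ es ++ E₀ → ¬ Cov e [] U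
      to U⊆X ind e∈ cov with ∈-++⁻ es e∈
      ... | inj₂ e∈E₀ = ind e∈E₀ λ x∈e → inj₂ ([ (λ ()) , id ]′ (cov x∈e))
      ... | inj₁ e∈es = v∉X (U⊆X ([ (λ ()) , id ]′ (cov (es∋v e∈es))))

    no-v : Zs F [] (v ∷ []) X ≈ 0#
    no-v = Sum-0 X λ {U} U⊆X →
      ι-cong (feasible? F [] (v ∷ []) U) (no λ (_ , p) → v∉X (U⊆X (p (here refl)))) (mk⇔ id id)

  -- Outside `X` both sums over `V` share the factor `Zs E [] [] (V ∖ X)`. In `cross` this factor
  -- and `Q` stand on both sides, so nothing is cancelled; subtracting the product of the two
  -- in-parts turns totals into out-parts.
  Rep-total : ∀ {V E v a b} → Unique V → (∀ {e} → e ∈ E → ¬ (e ⊆ [])) → Rep V E [] (v ∷ []) a b →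
    Zs E [] (v ∷ []) V * (a - b) ≈ b * (Zs E [] [] V - Zs E [] (v ∷ []) V)
  Rep-total {V} {E} {v} {a} {b} uV E⊈ r = begin
    Zs E [] (v ∷ []) V * (a - b)         ≈⟨ *-distribˡ-minus _ _ _ ⟩
    Zs E [] (v ∷ []) V * a - Zs E [] (v ∷ []) V * b
      ≈⟨ +-cong cross (-‿cong (*-comm _ _)) ⟩
    b * Zs E [] [] V - b * Zs E [] (v ∷ []) V ≈⟨ *-distribˡ-minus _ _ _ ⟨
    b * (Zs E [] [] V - Zs E [] (v ∷ []) V) ∎
    where
    open Rep r
    open import Algebra.Properties.Ring ring using (-‿distribʳ-*)
    *-distribˡ-minus : ∀ x y z → x * (y - z) ≈ x * y - x * z
    *-distribˡ-minus x y z = ≈-trans (distribˡ x y (- z)) (+-congˡ (≈-sym (-‿distribʳ-* x z)))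
    split : ∀ K → K ⊆ X → Zs E [] K V ≈ Zs (E ⟍ []) [] K X * Zs E [] [] (V ∖ X)
    split K K⊆X = Zs-split {E} {[]} {K} {E ⟍ []} {[]} {K} {E} {[]} {[]} uV X-unique
      (Unique.filter⁺ _ uV) (∖-disjoint X V) (to' , from')
      λ {U₁} p q → mk⇔ (to {U₁} p q) (from p q)
      where
      to' : V ⊆ X ++ V ∖ X
      to' {x} p with x ∈? X
      ... | yes q = ∈-++⁺ˡ q
      ... | no q  = ∈-++⁺ʳ X (∈∖⁺ p q)
      from' : X ++ V ∖ X ⊆ V
      from' = [ X⊆V , proj₁ ∘ ∈∖⁻ {V} ]′ ∘ ∈-++⁻ X
      to : ∀ {U₁ U₂} → U₁ ⊆ X → U₂ ⊆ V ∖ X → Feasible E [] K (U₁ ++ U₂) →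
           Feasible (E ⟍ []) [] K U₁ × Feasible E [] [] U₂
      to {U₁} p q (ind , K⊆) =
        ((λ e∈ cov → ind (proj₁ (∈⟍⁻ {E} e∈)) (cov-++ˡ cov)) ,
         λ x∈K → [ id , (λ x∈U₂ → contradiction (K⊆X x∈K) (proj₂ (∈∖⁻ {V} (q x∈U₂)))) ]′
                 (∈-++⁻ U₁ (K⊆ x∈K))) ,
        ((λ e∈ cov → ind e∈ (cov-++ʳ U₁ cov)) , λ ())
      from : ∀ {U₁ U₂} → U₁ ⊆ X → U₂ ⊆ V ∖ X →
             Feasible (E ⟍ []) [] K U₁ × Feasible E [] [] U₂ → Feasible E [] K (U₁ ++ U₂)
      from {U₁} {U₂} p q ((ind₁ , K⊆) , (ind₂ , _)) = ind , ∈-++⁺ˡ ∘ K⊆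
        where
        ind : ∀ {e} → e ∈ E → ¬ Cov e [] (U₁ ++ U₂)
        ind e∈ cov with closed e∈
        ... | inj₁ cX = ind₁ (∈⟍⁺ e∈ (E⊈ e∈)) (cov-dropʳ U₁ cov λ x∈e x∈U₂ →
                [ id , (λ x∈X → contradiction x∈X (proj₂ (∈∖⁻ {V} (q x∈U₂)))) ]′ (cX x∈e))
        ... | inj₂ e#X = ind₂ e∈ (cov-dropˡ U₁ cov λ x∈e x∈U₁ → contradiction (x∈e , p x∈U₁) e#X)
    cross : Zs E [] (v ∷ []) V * a ≈ b * Zs E [] [] V
    cross = begin
      Zs E [] (v ∷ []) V * a ≈⟨ *-cong (split (v ∷ []) K⊆X) a≈ ⟩
      Zs (E ⟍ []) [] (v ∷ []) X * Zs E [] [] (V ∖ X) * (Q * Zs (E ⟍ []) [] [] X)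
        ≈⟨ solve 4 (λ x z q y → (x ⊕ z) ⊕ (q ⊕ y) ⊜ (q ⊕ x) ⊕ (y ⊕ z)) ≈-refl _ _ _ _ ⟩
      Q * Zs (E ⟍ []) [] (v ∷ []) X * (Zs (E ⟍ []) [] [] X * Zs E [] [] (V ∖ X))
        ≈⟨ *-cong b≈ (split [] λ ()) ⟨
      b * Zs E [] [] V ∎

  Rep-≈ : ∀ {V E S K a b a' b'} → a ≈ a' → b ≈ b' → Rep V E S K a b → Rep V E S K a' b'
  Rep-≈ a≈a' b≈b' r = record
    { Rep r ; a≈ = ≈-trans (≈-sym a≈a') (Rep.a≈ r) ; b≈ = ≈-trans (≈-sym b≈b') (Rep.b≈ r) }

  RootRep-≈ : ∀ {V E₀ es v a b a' b'} → a ≈ a' → b ≈ b' →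
    RootRep V E₀ es v a b → RootRep V E₀ es v a' b'
  RootRep-≈ a≈a' b≈b' r = record
    { RootRep r ; a≈ = ≈-trans (≈-sym a≈a') (RootRep.a≈ r) ; b≈ = ≈-trans (≈-sym b≈b') (RootRep.b≈ r) }

-- Edge deletion, vertex removal and connected components.

module Residuals {A : Set} (_≟_ : DecidableEquality A) where
  open FiniteSets _≟_
  open Ops _≟_

  record Good (H : Hypergraph A) : Set where
    field
      V-unique   : Unique (V H)
      E-nonempty : ∀ {e} → e ∈ E H → ¬ (e ⊆ [])
      E-⊆V       : ∀ {e} → e ∈ E H → e ⊆ V H
      E-unique   : ∀ {e} → e ∈ E H → Unique e
  open Good

  wellFormed⇒good : ∀ {H} → WellFormed H → Good H
  wellFormed⇒good wf = record
    { V-unique   = WellFormed.V-unique wf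
    ; E-nonempty = λ e∈ e⊆[] → All.lookup (WellFormed.E-nonempty wf) e∈ (⊆[]⇒≡[] e⊆[])
    ; E-⊆V       = λ e∈ → All.lookup (All.lookup (WellFormed.E-⊆V wf) e∈)
    ; E-unique   = All.lookup (WellFormed.E-unique wf)
    }
    where
    ⊆[]⇒≡[] : ∀ {e : List A} → e ⊆ [] → e ≡ []
    ⊆[]⇒≡[] {[]}    _   = refl
    ⊆[]⇒≡[] {_ ∷ _} e⊆ with () ← e⊆ (here refl)

  removeFirst-⊆ : ∀ i v es → removeFirst i v es ⊆ es
  removeFirst-⊆ zero    v es p = p
  removeFirst-⊆ (suc i) v (e ∷ es) p with v ∈? e
  removeFirst-⊆ (suc i) v (e ∷ es) p         | yes _ = there (removeFirst-⊆ i v es p)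
  removeFirst-⊆ (suc i) v (e ∷ es) (here p)  | no _  = here p
  removeFirst-⊆ (suc i) v (e ∷ es) (there p) | no _  = there (removeFirst-⊆ (suc i) v es p)

  -- Only as sets: `removeFirst` keeps the original order, while the telescoping wants the surviving
  -- edges at `v` apart from those avoiding it.
  removeFirst-sameSet : ∀ i v es →
    SameSet (removeFirst i v es) (drop i (filter (v ∈?_) es) ++ filter (λ e → ¬? (v ∈? e)) es)
  removeFirst-sameSet zero v es = to , from
    where
    to : es ⊆ filter (v ∈?_) es ++ filter (λ e → ¬? (v ∈? e)) es
    to {e} p with v ∈? e
    ... | yes q = ∈-++⁺ˡ (∈-filter⁺ (v ∈?_) p q)
    ... | no q  = ∈-++⁺ʳ (filter (v ∈?_) es) (∈-filter⁺ (λ e → ¬? (v ∈? e)) p q)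
    from : filter (v ∈?_) es ++ filter (λ e → ¬? (v ∈? e)) es ⊆ es
    from p with ∈-++⁻ (filter (v ∈?_) es) p
    ... | inj₁ q = proj₁ (∈-filter⁻ (v ∈?_) {xs = es} q)
    ... | inj₂ q = proj₁ (∈-filter⁻ (λ e → ¬? (v ∈? e)) {xs = es} q)
  removeFirst-sameSet (suc i) v [] = id , id
  removeFirst-sameSet (suc i) v (e ∷ es) with v ∈? e
  ... | yes _ = removeFirst-sameSet i v es
  ... | no _  = to , from
    where
    post = drop (suc i) (filter (v ∈?_) es)
    ih = removeFirst-sameSet (suc i) v es
    to : e ∷ removeFirst (suc i) v es ⊆ post ++ e ∷ filter (λ e → ¬? (v ∈? e)) es
    to (here p) = ∈-++⁺ʳ post (here p)
    to (there p) = [ ∈-++⁺ˡ , ∈-++⁺ʳ post ∘ there ]′ (∈-++⁻ post (proj₁ ih p))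
    from : post ++ e ∷ filter (λ e → ¬? (v ∈? e)) es ⊆ e ∷ removeFirst (suc i) v es
    from p with ∈-++⁻ post p
    ... | inj₁ q         = there (proj₂ ih (∈-++⁺ˡ q))
    ... | inj₂ (here q)  = here q
    ... | inj₂ (there q) = there (proj₂ ih (∈-++⁺ʳ post q))

  deleteEdges-good : ∀ {H} i v → Good H → Good (deleteEdges i v H)
  deleteEdges-good {H} i v g = record
    { V-unique   = V-unique g
    ; E-nonempty = E-nonempty g ∘ sub
    ; E-⊆V       = λ e∈ → E-⊆V g (sub e∈)
    ; E-unique   = E-unique g ∘ sub
    }
    where
    sub = removeFirst-⊆ i v (E H)

  ⊖-edge⁻ : ∀ H S {f} → f ∈ E (H ⊖ S) → ∃[ e ] e ∈ E H × ¬ (e ⊆ S) × f ≡ e ∖ S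
  ⊖-edge⁻ H S f∈ =
    let e , e∈ , f≡ = ∈-map⁻ (_∖ S) (AnyP.deduplicate⁻ sameSet? f∈)
        e∈E , e⊈S = ∈-filter⁻ (λ e → ¬? (e ⊆? S)) {xs = E H} e∈
    in e , e∈E , (λ e⊆S → e⊈S (All.tabulate e⊆S)) , f≡

  -- `f` need not be the list `e ∖ S`, since deduplication may have kept the equal residual of
  -- another edge.
  ⊖-edge⁺ : ∀ H S {e} → e ∈ E H → ¬ (e ⊆ S) → ∃[ f ] f ∈ E (H ⊖ S) × SameSet f (e ∖ S)
  ⊖-edge⁺ H S {e} e∈E e⊈S = find (AnyP.deduplicate⁺ sameSet? resp
    (lose (∈-map⁺ (_∖ S) (∈-filter⁺ (λ e → ¬? (e ⊆? S)) e∈E (λ a → e⊈S (All.lookup a)))) (id , id)))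
    where
    resp : ∀ {f g} → All (_∈ f) g × All (_∈ g) f → SameSet f (e ∖ S) → SameSet g (e ∖ S)
    resp (g⊆f , f⊆g) (p , q) = p ∘ All.lookup g⊆f , All.lookup f⊆g ∘ q

  ⊖-good : ∀ {H} S → Good H → Good (H ⊖ S)
  ⊖-good {H} S g = record
    { V-unique   = Unique.filter⁺ _ (V-unique g)
    ; E-nonempty = nonempty
    ; E-⊆V       = ⊆V
    ; E-unique   = unique
    }
    where
    nonempty : ∀ {f} → f ∈ E (H ⊖ S) → ¬ (f ⊆ [])
    nonempty f∈ f⊆[] with ⊖-edge⁻ H S f∈
    ... | e , _ , e⊈S , refl = e⊈S e⊆S
      where
      e⊆S : e ⊆ S
      e⊆S {x} x∈e with x ∈? S
      ... | yes x∈S = x∈S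
      ... | no x∉S with () ← f⊆[] (∈∖⁺ x∈e x∉S)
    ⊆V : ∀ {f} → f ∈ E (H ⊖ S) → f ⊆ V H ∖ S
    ⊆V f∈ x∈f with ⊖-edge⁻ H S f∈
    ... | e , e∈E , _ , refl = let x∈e , x∉S = ∈∖⁻ {e} x∈f in ∈∖⁺ (E-⊆V g e∈E x∈e) x∉S
    unique : ∀ {f} → f ∈ E (H ⊖ S) → Unique f
    unique f∈ with ⊖-edge⁻ H S f∈
    ... | e , e∈E , _ , refl = Unique.filter⁺ _ (E-unique g e∈E)

  module _ (H : Hypergraph A) where
    Stable : List A → Set
    Stable C = closeStep H C ⊆ C

    Step : List A → A → Set
    Step C x = x ∈ C ⊎ Any (λ e → x ∈ e × Any (_∈ C) e) (E H)

    step? : ∀ C → Decidable (Step C)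
    step? C x = (x ∈? C) ⊎-dec any? (λ e → (x ∈? e) ×-dec any? (_∈? C) e) (E H)

    closeStep⁻ : ∀ {C x} → x ∈ closeStep H C → x ∈ V H × Step C x
    closeStep⁻ {C} = ∈-filter⁻ (step? C) {xs = V H}

    closeStep⁺ : ∀ {C x} → x ∈ V H → Step C x → x ∈ closeStep H C
    closeStep⁺ {C} = ∈-filter⁺ (step? C)

    closeStep-mono : ∀ {C C'} → C ⊆ C' → closeStep H C ⊆ closeStep H C'
    closeStep-mono sub p =
      let x∈V , s = closeStep⁻ p in
      closeStep⁺ x∈V (Sum.map sub (Any.map (λ (x∈e , q) → x∈e , Any.map sub q)) s)

    closeStep-⊇ : ∀ {C} → C ⊆ V H → C ⊆ closeStep H C
    closeStep-⊇ C⊆V x∈C = closeStep⁺ (C⊆V x∈C) (inj₁ x∈C)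

    closeStep-⊆V : ∀ {C} → closeStep H C ⊆ V H
    closeStep-⊆V p = proj₁ (closeStep⁻ p)

    iterate-⊇ : ∀ n {C} → C ⊆ V H → C ⊆ iterate n H C
    iterate-⊇ zero    C⊆V p = p
    iterate-⊇ (suc n) C⊆V p = iterate-⊇ n closeStep-⊆V (closeStep-⊇ C⊆V p)

    iterate-stable : ∀ n {C} → Stable C → Stable (iterate n H C)
    iterate-stable zero    s = s
    iterate-stable (suc n) s = iterate-stable n (closeStep-mono s)

    -- Every unstable step adds a vertex, so a budget of ∣V∣ steps suffices.
    iterate-reaches-stable : ∀ n {C} → Unique (V H) → Unique C → C ⊆ V H →
      length (V H) ≤ n ℕ.+ length C →
      Stable (iterate n H C)
    iterate-reaches-stable n {C} uV uC C⊆V bound with closeStep H C ⊆ₗ? C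
    ... | yes s = iterate-stable n s
    iterate-reaches-stable zero {C} uV uC C⊆V bound | no ¬s = contradiction (λ {x} → stable {x}) ¬s
      where
      stable : Stable C
      stable {x} p with x ∈? C
      ... | yes q = q
      ... | no x∉C = contradiction (≤-trans (unique-⊆⇒length-≤ (All.tabulate (λ { q refl → x∉C q }) ∷ uC) uV
                       λ { (here refl) → closeStep-⊆V p ; (there q) → C⊆V q }) bound) (<⇒≱ ≤-refl)
    iterate-reaches-stable (suc n) {C} uV uC C⊆V bound | no ¬s =
      iterate-reaches-stable n uV uC' closeStep-⊆V
        (≤-trans bound (≤-trans (≤-reflexive (≡.sym (+-suc n _))) (+-monoʳ-≤ n grows)))
      where
      uC' = Unique.filter⁺ (step? C) uV
      grows : length C < length (closeStep H C)
      grows with length C <? length (closeStep H C)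
      ... | yes lt = lt
      ... | no ¬lt = contradiction (λ {x} → stable {x}) ¬s
        where
        stable : Stable C
        stable {x} p with x ∈? C
        ... | yes q = q
        ... | no x∉C = contradiction (unique-⊆⇒length-≤ (All.tabulate (λ { q refl → x∉C q }) ∷ uC) uC'
                         λ { (here refl) → p ; (there q) → closeStep-⊇ C⊆V q }) ¬lt

  componentSet : Hypergraph A → A → List A
  componentSet H u = iterate (length (V H)) H (u ∷ [])

  module _ {H : Hypergraph A} {u : A} (g : Good H) (u∈V : u ∈ V H) where
    private
      C = componentSet H u
      u⊆V : u ∷ [] ⊆ V H
      u⊆V (here refl) = u∈V

    -- One more round would absorb every edge that meets `C`; as `C` is stable, such an edge already
    -- lies in it.
    componentSet-closed : Closed (E H) [] C
    componentSet-closed {e} e∈ with any? (_∈? C) e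
    ... | no ¬p = inj₂ λ (x∈e , x∈C) → ¬p (lose x∈e x∈C)
    ... | yes p = inj₁ λ x∈e → inj₂ (iterate-reaches-stable H (length (V H)) (V-unique g) ([] ∷ []) u⊆V
            (m≤m+n _ 1) (closeStep⁺ H (E-⊆V g e∈ x∈e) (inj₂ (lose e∈ (x∈e , p)))))

    ∈-component : u ∈ V (component H u)
    ∈-component = ∈-filter⁺ (_∈? C) u∈V (iterate-⊇ H (length (V H)) u⊆V (here refl))

  component-edge⁻ : ∀ H u {f} → f ∈ E (component H u) → f ∈ E H × f ⊆ componentSet H u
  component-edge⁻ H u f∈ = let p , q = ∈-filter⁻ (_⊆? componentSet H u) {xs = E H} f∈ in p , All.lookup q

  component-edge⁺ : ∀ H u {f} → f ∈ E H → f ⊆ componentSet H u → f ∈ E (component H u)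
  component-edge⁺ H u f∈ f⊆ = ∈-filter⁺ (_⊆? componentSet H u) f∈ (All.tabulate f⊆)

  component-good : ∀ {H} u → Good H → Good (component H u)
  component-good {H} u g = record
    { V-unique   = Unique.filter⁺ _ (V-unique g)
    ; E-nonempty = E-nonempty g ∘ proj₁ ∘ component-edge⁻ H u
    ; E-⊆V       = λ f∈ x∈f → let p , q = component-edge⁻ H u f∈ in
                     ∈-filter⁺ (_∈? componentSet H u) (E-⊆V g p x∈f) (q x∈f)
    ; E-unique   = E-unique g ∘ proj₁ ∘ component-edge⁻ H u
    }

  module _ (R : CommutativeRing 0ℓ 0ℓ) (w : A → CommutativeRing.Carrier R) where
    open Multiples R _≟_ w

    Rep-component : ∀ {H S u a b} → Good H → u ∈ V (H ⊖ S) →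
      Rep (V (component (H ⊖ S) u)) (E (component (H ⊖ S) u)) [] (u ∷ []) a b →
      Rep (V H) (E H) S (u ∷ []) a b
    Rep-component {H} {S} {u} g u∈ =
      Rep-residual (proj₁ ∘ V'⁻) (λ (p , q) → proj₂ (V'⁻ p) q) down up
      where
      G = H ⊖ S
      C = componentSet G u
      V'⁻ : ∀ {x} → x ∈ V (component G u) → x ∈ V H × x ∉ S
      V'⁻ p = ∈∖⁻ {V H} (proj₁ (∈-filter⁻ (_∈? C) {xs = V G} p))
      down : ∀ {e} → e ∈ E H → ¬ (e ⊆ S) →
             (∃[ f ] f ∈ E (component G u) × SameSet f (e ∖ S)) ⊎ Disjoint e (V (component G u))
      down e∈ e⊈S with ⊖-edge⁺ H S e∈ e⊈S
      ... | f , f∈ , same with componentSet-closed (⊖-good S g) u∈ f∈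
      ...   | inj₁ cov = inj₁ (f , component-edge⁺ G u f∈ (λ x∈f → [ (λ ()) , id ]′ (cov x∈f)) , same)
      ...   | inj₂ f#C = inj₂ λ (x∈e , x∈V') →
              f#C (proj₂ same (∈∖⁺ x∈e (proj₂ (V'⁻ x∈V'))) , proj₂ (∈-filter⁻ (_∈? C) {xs = V G} x∈V'))
      up : ∀ {f} → f ∈ E (component G u) → ∃[ e ] e ∈ E H × ¬ (e ⊆ S) × SameSet f (e ∖ S)
      up f∈ with ⊖-edge⁻ H S (proj₁ (component-edge⁻ G u f∈))
      ... | e , e∈ , e⊈S , refl = e , e∈ , e⊈S , id , id

-- Positions in an enumerated list.

module _ {B : Set} where
  enumFrom : ℕ → List B → List (ℕ × B)
  enumFrom n []       = []
  enumFrom n (x ∷ xs) = (n , x) ∷ enumFrom (suc n) xs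

  drop-∷ : ∀ n (xs : List B) {y ys} → drop n xs ≡ y ∷ ys →
    take (suc n) xs ≡ take n xs ++ y ∷ [] × drop (suc n) xs ≡ ys
  drop-∷ zero    (x ∷ xs) refl = refl , refl
  drop-∷ (suc n) (x ∷ xs) eq with drop-∷ n xs eq
  ... | t , d = ≡.cong (x ∷_) t , d

  drop-∷-∈ : ∀ n (xs : List B) {y ys} → drop n xs ≡ y ∷ ys → y ∈ xs
  drop-∷-∈ zero    (x ∷ xs) refl = here refl
  drop-∷-∈ (suc n) (x ∷ xs) eq   = there (drop-∷-∈ n xs eq)

  drop-∷-∉ : ∀ n (xs : List B) {y ys} → Unique xs → drop n xs ≡ y ∷ ys → y ∉ take n xs
  drop-∷-∉ (suc n) (x ∷ xs) (x≢ ∷ u) eq (here refl) = All.lookup x≢ (drop-∷-∈ n xs eq) refl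
  drop-∷-∉ (suc n) (x ∷ xs) (x≢ ∷ u) eq (there p)   = drop-∷-∉ n xs u eq p

-- Partition functions of subtrees glued under a new root.

module Grafting (R : CommutativeRing 0ℓ 0ℓ) {B : Set} (_≟_ : DecidableEquality B)
                (w : B → CommutativeRing.Carrier R) where
  open CommutativeRing R renaming (refl to ≈-refl; sym to ≈-sym; trans to ≈-trans)
  open import Relation.Binary.Reasoning.Setoid setoid
  open FiniteSets _≟_
  open Sums R _≟_ w
  open Multiples R _≟_ w using (Zs-∷)

  Zs-[] : ∀ {S} → Zs [] S [] [] ≈ 1#
  Zs-[] {S} = ι-cong (feasible? [] S [] []) (yes ((λ ()) , λ ())) (mk⇔ id id)

  Zs-disjoint-++ : ∀ {E E₁ E₂ S K₁ K₂ X Y} → SameSet E (E₁ ++ E₂) →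
    (∀ {e} → e ∈ E₁ → Cov e S X) → (∀ {e} → e ∈ E₂ → Cov e S Y) → Disjoint X Y →
    K₁ ⊆ X → K₂ ⊆ Y →
    Zs E S (K₁ ++ K₂) (X ++ Y) ≈ Zs E₁ S K₁ X * Zs E₂ S K₂ Y
  Zs-disjoint-++ {E} {E₁} {E₂} {S} {K₁} {K₂} {X} {Y} (E⊆ , ⊆E) cov₁ cov₂ X#Y K₁⊆ K₂⊆ =
    Zs-++ {E} {S} {K₁ ++ K₂} {E₁} {S} {K₁} {E₂} {S} {K₂} λ {U₁} p q → mk⇔ (to {U₁} p q) (from p q)
    where
    to : ∀ {U₁ U₂} → U₁ ⊆ X → U₂ ⊆ Y → Feasible E S (K₁ ++ K₂) (U₁ ++ U₂) →
         Feasible E₁ S K₁ U₁ × Feasible E₂ S K₂ U₂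
    to {U₁} p q (ind , K⊆) =
      ((λ e∈ cov → ind (⊆E (∈-++⁺ˡ e∈)) (cov-++ˡ cov)) ,
       λ x∈ → [ id , (λ x∈U₂ → contradiction (K₁⊆ x∈ , q x∈U₂) X#Y) ]′ (∈-++⁻ U₁ (K⊆ (∈-++⁺ˡ x∈)))) ,
      ((λ e∈ cov → ind (⊆E (∈-++⁺ʳ E₁ e∈)) (cov-++ʳ U₁ cov)) ,
       λ x∈ → [ (λ x∈U₁ → contradiction (p x∈U₁ , K₂⊆ x∈) X#Y) , id ]′ (∈-++⁻ U₁ (K⊆ (∈-++⁺ʳ K₁ x∈))))
    from : ∀ {U₁ U₂} → U₁ ⊆ X → U₂ ⊆ Y → Feasible E₁ S K₁ U₁ × Feasible E₂ S K₂ U₂ →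
           Feasible E S (K₁ ++ K₂) (U₁ ++ U₂)
    from {U₁} {U₂} p q ((ind₁ , K₁⊆U₁) , (ind₂ , K₂⊆U₂)) =
      ind , λ x∈ → [ ∈-++⁺ˡ ∘ K₁⊆U₁ , ∈-++⁺ʳ U₁ ∘ K₂⊆U₂ ]′ (∈-++⁻ K₁ x∈)
      where
      ind : ∀ {e} → e ∈ E → ¬ Cov e S (U₁ ++ U₂)
      ind e∈ cov with ∈-++⁻ E₁ (E⊆ e∈)
      ... | inj₁ e∈₁ = ind₁ e∈₁ (cov-dropʳ U₁ cov λ x∈e x∈U₂ →
              [ id , (λ x∈X → contradiction (x∈X , q x∈U₂) X#Y) ]′ (cov₁ e∈₁ x∈e))
      ... | inj₂ e∈₂ = ind₂ e∈₂ (cov-dropˡ U₁ cov λ x∈e x∈U₁ →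
              [ id , (λ x∈Y → contradiction (p x∈U₁ , x∈Y) X#Y) ]′ (cov₂ e∈₂ x∈e))

  -- The edges of `E` avoid `r`, so forcing it changes neither sum; the sets then lost to the edge
  -- `r ∷ K` are those containing `K`.
  Zs-addEdge : ∀ {E r K X} → (∀ {e} → e ∈ E → e ⊆ X) → r ∉ X → K ⊆ X →
    Zs E [] [] X - Zs E [] K X ≈ Zs ((r ∷ K) ∷ E) (r ∷ []) [] X
  Zs-addEdge {E} {r} {K} {X} E⊆X r∉X K⊆X = begin
    Zs E [] [] X - Zs E [] K X               ≈⟨ +-cong (force-r []) (-‿cong (force-r K)) ⟩
    Zs E (r ∷ []) [] X - Zs E (r ∷ []) K X
      ≈⟨ +-congʳ (Zs-∷ E (r ∷ []) (r ∷ K) K X (id , id) λ { (p , here refl) → r∉X (K⊆X p) }) ⟩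
    Zs ((r ∷ K) ∷ E) (r ∷ []) [] X + Zs E (r ∷ []) K X - Zs E (r ∷ []) K X
      ≈⟨ ≈-trans (+-assoc _ _ _) (≈-trans (+-congˡ (-‿inverseʳ _)) (+-identityʳ _)) ⟩
    Zs ((r ∷ K) ∷ E) (r ∷ []) [] X ∎
    where
    force-r : ∀ K → Zs E [] K X ≈ Zs E (r ∷ []) K X
    force-r K = Zs-cong {E} {[]} {K} {E} {r ∷ []} {K} {X} λ _ → mk⇔
      (λ (ind , K⊆) → (λ e∈ cov → ind e∈ λ x∈e →
        [ (λ { (here refl) → contradiction (E⊆X e∈ x∈e) r∉X }) , inj₂ ]′ (cov x∈e)) , K⊆)
      (λ (ind , K⊆) → (λ e∈ cov → ind e∈ λ x∈e → [ (λ ()) , inj₂ ]′ (cov x∈e)) , K⊆)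

  module _ {E D : List (List B)} {r : B} {X : List B} (r∉X : r ∉ X) (D∋r : ∀ {e} → e ∈ D → r ∈ e) where
    private
      without-r : Zs (E ++ D) [] [] X ≈ Zs E [] [] X
      without-r = Zs-cong {E ++ D} {[]} {[]} {E} {[]} {[]} {X} λ U⊆X → mk⇔
        (λ (ind , _) → (λ e∈ → ind (∈-++⁺ˡ e∈)) , λ ())
        (λ (ind , _) → (λ e∈ cov → [ (λ e∈E → ind e∈E cov) ,
            (λ e∈D → [ (λ ()) , (λ p → r∉X (U⊆X p)) ]′ (cov (D∋r e∈D))) ]′ (∈-++⁻ E e∈)) , λ ())
      with-r : ∀ K → K ⊆ r ∷ [] →
        Sum X (λ U → ι (feasible? (E ++ D) [] K (r ∷ U))) ≈ Zs (E ++ D) (r ∷ []) [] X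
      with-r K K⊆ = Sum-cong X λ {U} _ →
        ι-cong (feasible? (E ++ D) [] K (r ∷ U)) (feasible? (E ++ D) (r ∷ []) [] U) (mk⇔
          (λ (ind , _) → (λ e∈ cov → ind e∈ λ x∈ →
              inj₂ ([ (λ { (here p) → here p }) , there ]′ (cov x∈))) , λ ())
          (λ (ind , _) → (λ e∈ cov → ind e∈ λ x∈ →
              [ (λ ()) , (λ { (here p) → inj₁ (here p) ; (there p) → inj₂ p }) ]′ (cov x∈)) ,
            λ x∈K → ∈-++⁺ˡ (K⊆ x∈K)))
      no-r : Zs (E ++ D) [] (r ∷ []) X ≈ 0#
      no-r = Sum-0 X λ {U} U⊆X →
        ι-cong (feasible? (E ++ D) [] (r ∷ []) U) (no λ (_ , p) → r∉X (U⊆X (p (here refl)))) (mk⇔ id id)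

    -- Every edge of `D` contains `r` and so constrains only the sets with `r`.
    Zs-root : Zs (E ++ D) [] [] (r ∷ X) ≈ w r * Zs (E ++ D) (r ∷ []) [] X + Zs E [] [] X
    Zs-root = +-cong (*-congˡ (with-r [] λ ())) without-r

    Zs-root-in : Zs (E ++ D) [] (r ∷ []) (r ∷ X) ≈ w r * Zs (E ++ D) (r ∷ []) [] X
    Zs-root-in = ≈-trans
      (+-cong (*-congˡ (with-r (r ∷ []) λ { (here refl) → here refl })) no-r) (+-identityʳ _)

-- Induction along the Weitz-hypertree.

module WeitzTree (R : CommutativeRing 0ℓ 0ℓ) {A : Set} (_≟_ : DecidableEquality A)
                 (dec : (H : Hypergraph A) → Dec (IsLinearHypertree H))
                 (w : A → CommutativeRing.Carrier R) where
  open CommutativeRing R renaming (refl to ≈-refl; sym to ≈-sym; trans to ≈-trans)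
  open FiniteSets _≟_
  open Ops _≟_
  open Residuals _≟_
  open Multiples R _≟_ w
  open Weitz _≟_ dec
  module S = Sums R _≟_ w
  module T = Sums R _≟T_ (w ∘ proj₂)
  module G = Grafting R _≟T_ (w ∘ proj₂)

  -- enum's local recursion cannot be named; abstracting its start index lets Agda infer it.
  mutual
    enum-go≡enumFrom : {B : Set} (n : ℕ) (xs : List B) → _ ≡ enumFrom n xs
    enum-go≡enumFrom n []       = refl
    enum-go≡enumFrom n (x ∷ xs) = ≡.cong ((n , x) ∷_) (enum-go≡enumFrom (suc n) xs)

    enum≡enumFrom : {B : Set} (xs : List B) → enum xs ≡ enumFrom 1 xs
    enum≡enumFrom xs with 1
    ... | n = enum-go≡enumFrom n xs

  Below : List ℕ → TVertex A → Set
  Below p x = ∃[ q ] proj₁ x ≡ p ++ q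

  -- The reason why the subtrees of one root have disjoint vertex sets.
  below-branch : ∀ {p i j i' j'} {x : TVertex A} →
    Below (p ++ i ∷ j ∷ []) x → Below (p ++ i' ∷ j' ∷ []) x → i ≡ i' × j ≡ j'
  below-branch {p} {i} {j} {i'} {j'} (q , eq) (q' , eq')
    with refl ← ++-cancelˡ p (i ∷ j ∷ q) (i' ∷ j' ∷ q')
      (≡.trans (≡.sym (++-assoc p (i ∷ j ∷ []) q))
        (≡.trans (≡.sym eq) (≡.trans eq' (++-assoc p (i' ∷ j' ∷ []) q')))) = refl , refl

  root-not-below : ∀ {p i j} {v : A} → ¬ Below (p ++ i ∷ j ∷ []) (p , v)
  root-not-below {p} {i} {j} (q , eq)
    with () ← ++-cancelˡ p [] (i ∷ j ∷ q)
      (≡.trans (++-identityʳ p) (≡.trans eq (++-assoc p (i ∷ j ∷ []) q)))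

  -- `rep` is the inductive claim. The other fields are what gluing `T` under a root uses: addresses
  -- that separate subtrees, edges that stay inside `T`, and a root that is one of its vertices.
  record Represents (p : List ℕ) (v : A) (T : Hypergraph (TVertex A)) (H : Hypergraph A) : Set where
    field
      below : ∀ {x} → x ∈ V T → Below p x
      edge⊆ : ∀ {e} → e ∈ E T → e ⊆ V T
      root∈ : (p , v) ∈ V T
      rep   : Rep (V H) (E H) [] (v ∷ [])
                (T.Zs (E T) [] [] (V T)) (T.Zs (E T) [] ((p , v) ∷ []) (V T))

  -- A relabelled copy has the same sums, so the whole of `V H` and the multiplier 1 do. This serves
  -- both places where the recursion stops: at a hypertree and at fuel zero.
  lift-represents : ∀ p H v → Good H → v ∈ V H → Represents p v (lift p H) H
  lift-represents p H v g v∈V = record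
    { below = λ x∈ → let _ , _ , eq = ∈-map⁻ (p ,_) x∈ in
        [] , ≡.trans (≡.cong proj₁ eq) (≡.sym (++-identityʳ p))
    ; edge⊆ = edge
    ; root∈ = ∈-map⁺ (p ,_) v∈V
    ; rep   = record
      { X = V H ; X-unique = Good.V-unique g ; X⊆V = id ; K⊆X = λ { (here refl) → v∈V }
      ; X#S = λ () ; closed = λ e∈ → inj₁ (inj₂ ∘ Good.E-⊆V g e∈)
      ; Q = 1# ; a≈ = value [] ; b≈ = value (v ∷ []) } }
    where
    edge : ∀ {e} → e ∈ map (map (p ,_)) (E H) → e ⊆ map (p ,_) (V H)
    edge e∈ x∈ with ∈-map⁻ (map (p ,_)) e∈
    ... | f , f∈ , refl with ∈-map⁻ (p ,_) x∈
    ...   | y , y∈ , refl = ∈-map⁺ (p ,_) (Good.E-⊆V g f∈ y∈)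
    unmap : ∀ {y : A} {U} → (p , y) ∈ map (p ,_) U → y ∈ U
    unmap q with ∈-map⁻ (p ,_) q
    ... | y , y∈ , refl = y∈
    Sum-map : ∀ X F → T.Sum (map (p ,_) X) F ≈ S.Sum X (F ∘ map (p ,_))
    Sum-map []      F = ≈-refl
    Sum-map (x ∷ X) F = +-cong (*-congˡ (Sum-map X _)) (Sum-map X F)
    F = E H ⟍ []
    to : ∀ {K U} → Feasible (map (map (p ,_)) (E H)) [] (map (p ,_) K) (map (p ,_) U) → Feasible F [] K U
    to {K} {U} (ind , K⊆) =
      (λ e∈ cov → ind (∈-map⁺ (map (p ,_)) (proj₁ (∈⟍⁻ {E H} e∈))) (cover cov)) ,
      λ x∈ → unmap (K⊆ (∈-map⁺ (p ,_) x∈))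
      where
      cover : ∀ {e} → Cov e [] U → Cov (map (p ,_) e) [] (map (p ,_) U)
      cover cov x∈ with ∈-map⁻ (p ,_) x∈
      ... | y , y∈ , refl = inj₂ ([ (λ ()) , ∈-map⁺ (p ,_) ]′ (cov y∈))
    from : ∀ {K U} → Feasible F [] K U → Feasible (map (map (p ,_)) (E H)) [] (map (p ,_) K) (map (p ,_) U)
    from {K} {U} (ind , K⊆) = ind' , sub
      where
      ind' : ∀ {e} → e ∈ map (map (p ,_)) (E H) → ¬ Cov e [] (map (p ,_) U)
      ind' e∈ cov with ∈-map⁻ (map (p ,_)) e∈
      ... | f , f∈ , refl = ind (∈⟍⁺ f∈ (Good.E-nonempty g f∈)) λ y∈ →
        inj₂ ([ (λ ()) , unmap ]′ (cov (∈-map⁺ (p ,_) y∈)))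
      sub : map (p ,_) K ⊆ map (p ,_) U
      sub x∈ with ∈-map⁻ (p ,_) x∈
      ... | y , y∈ , refl = ∈-map⁺ (p ,_) (K⊆ y∈)
    module FT = FiniteSets _≟T_
    value : ∀ K → T.Zs (map (map (p ,_)) (E H)) [] (map (p ,_) K) (map (p ,_) (V H))
                  ≈ 1# * S.Zs F [] K (V H)
    value K = ≈-trans (Sum-map (V H) _) (≈-trans (S.Sum-cong (V H) λ {U} _ →
        S.ι-cong (FT.feasible? (map (map (p ,_)) (E H)) [] (map (p ,_) K) (map (p ,_) U))
                 (feasible? F [] K U) (mk⇔ to from))
      (≈-sym (*-identityˡ _)))

  module Step (k : ℕ) (p : List ℕ) (H : Hypergraph A) (v : A) (g : Good H) (v∈V : v ∈ V H)
              (ih : ∀ p' H' u → Good H' → u ∈ V H' → Represents p' u (build k p' H' u) H') where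
    r : TVertex A
    r = p , v

    others : List A → List A
    others = filter (λ u → ¬? (u ≟ v))

    subtree : ℕ → List A → ℕ × A → Hypergraph (TVertex A)
    subtree i os (j , u) =
      build k (p ++ i ∷ j ∷ []) (component (deleteEdges i v H ⊖ (v ∷ take (j ∸ 1) os)) u) u

    rootAt : ℕ → ℕ × A → TVertex A
    rootAt i (j , u) = p ++ i ∷ j ∷ [] , u

    -- What remains of the `i`-th hyperedge once `v` and its first `j` other vertices are forced.
    -- The strict bound in `label` keeps this part disjoint from subtree `j`, the next one to be
    -- joined to it.
    record Branch (i : ℕ) (os : List A) (j : ℕ) (post : List A) (js : List (ℕ × A)) : Set where
      X  = concatMap V (map (subtree i os) js)
      D  = concatMap E (map (subtree i os) js)
      rs = map (rootAt i) js
      field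
        label : ∀ {x} → x ∈ X → ∃[ j' ] j < j' × Below (p ++ i ∷ j' ∷ []) x
        edge⊆ : ∀ {e} → e ∈ D → e ⊆ X
        root⊆ : rs ⊆ X
        rep   : Rep (V H) (removeFirst i v (E H)) (v ∷ take j os) post
                  (T.Zs D [] [] X) (T.Zs D [] rs X)

    branch : ∀ i os → Unique os → os ⊆ V H → v ∉ os → ∀ j post → drop j os ≡ post →
      Branch i os j post (enumFrom (suc j) post)
    branch i os uos os⊆V v∉os j [] eq = record
      { label = λ () ; edge⊆ = λ () ; root⊆ = λ ()
      ; rep = Rep-≈ (≈-sym G.Zs-[]) (≈-sym G.Zs-[]) Rep-empty }
    branch i os uos os⊆V v∉os j (u ∷ post) eq = record
      { label = λ x∈ → [ (λ x∈t → suc j , ≤-refl , t.below x∈t) ,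
                         (λ x∈b → let j' , j<j' , bel = b.label x∈b in j' , ≤-trans (n≤1+n _) j<j' , bel)
                       ]′ (∈-++⁻ (V t) x∈)
      ; edge⊆ = λ e∈ x∈ → [ (λ e∈t → ∈-++⁺ˡ (t.edge⊆ e∈t x∈)) ,
                          (λ e∈b → ∈-++⁺ʳ (V t) (b.edge⊆ e∈b x∈)) ]′
                          (∈-++⁻ (E t) e∈)
      ; root⊆ = λ { (here refl) → ∈-++⁺ˡ t.root∈ ; (there x∈) → ∈-++⁺ʳ (V t) (b.root⊆ x∈) }
      ; rep = Rep-≈
          (≈-sym (G.Zs-disjoint-++ {K₁ = []} {K₂ = []} (id , id)
                    (λ e∈ x∈ → inj₂ (t.edge⊆ e∈ x∈)) (λ e∈ x∈ → inj₂ (b.edge⊆ e∈ x∈))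
                    t#b (λ ()) (λ ())))
          (≈-sym (G.Zs-disjoint-++ {K₁ = rootAt i (suc j , u) ∷ []} (id , id)
                    (λ e∈ x∈ → inj₂ (t.edge⊆ e∈ x∈)) (λ e∈ x∈ → inj₂ (b.edge⊆ e∈ x∈))
                    t#b (λ { (here refl) → t.root∈ }) b.root⊆))
          (Rep-step (Rep-component R w {deleteEdges i v H} (deleteEdges-good i v g) u∈ t.rep)
            (≡.subst (λ S → Rep (V H) (removeFirst i v (E H)) (v ∷ S) post
                              (T.Zs b.D [] [] b.X) (T.Zs b.D [] b.rs b.X))
              (proj₁ next) b.rep)) }
      where
      next = drop-∷ j os eq
      b = branch i os uos os⊆V v∉os (suc j) post (proj₂ next)
      module b = Branch b
      G' = deleteEdges i v H ⊖ (v ∷ take j os)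
      gG' : Good G'
      gG' = ⊖-good (v ∷ take j os) (deleteEdges-good i v g)
      u∈os = drop-∷-∈ j os eq
      u∈ : u ∈ V G'
      u∈ = ∈∖⁺ (os⊆V u∈os) λ { (here refl) → v∉os u∈os ; (there q) → drop-∷-∉ j os uos eq q }
      -- Vertices are numbered from 1 and `subtree` removes the first `suc j ∸ 1` of them, which is
      -- exactly the `take j os` forced here.
      t = subtree i os (suc j , u)
      module t = Represents
        (ih (p ++ i ∷ suc j ∷ []) (component G' u) u (component-good u gG') (∈-component gG' u∈))
      t#b : Disjoint (V t) b.X
      t#b {x} (x∈t , x∈b) =
        let j' , j<j' , bel = b.label x∈b
            _ , j≡j' = below-branch {p} {i} {suc j} {i} {j'} {x} (t.below x∈t) bel
        in <⇒≢ j<j' j≡j'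

    E₀ : List (List A)
    E₀ = filter (λ e → ¬? (v ∈? e)) (E H)

    E₀⊈ : ∀ {f} → f ∈ E₀ → ¬ (f ⊆ v ∷ [])
    E₀⊈ {f} f∈ f⊆ = let f∈E , v∉f = ∈-filter⁻ (λ e → ¬? (v ∈? e)) {xs = E H} f∈ in
      Good.E-nonempty g f∈E (λ x∈f → ⊥-elim (bad v∉f x∈f (f⊆ x∈f)))
      where
      bad : v ∉ f → ∀ {x} → x ∈ f → x ∈ v ∷ [] → ⊥
      bad v∉f x∈f (here refl) = v∉f x∈f

    subtrees : List (ℕ × List A) → List (Hypergraph (TVertex A))
    subtrees = concatMap (λ (i , os) → map (subtree i os) (enum os))

    rootEdges : List (ℕ × List A) → List (List (TVertex A))
    rootEdges = map (λ (i , os) → r ∷ map (λ (j , u) → (p ++ i ∷ j ∷ [] , u)) (enum os))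

    labelled : List (ℕ × List A) → List (ℕ × List A)
    labelled = map (λ (i , e) → i , others e)

    -- The part of the tree belonging to the hyperedges at `v` after the first `i`, with `F` their
    -- root edges. The root is forced and left out of `X`, so its weight is not yet counted;
    -- `Zs-root` supplies it at the end.
    record Crown (i : ℕ) (es : List (List A)) (X : List (TVertex A))
                 (D F : List (List (TVertex A))) : Set where
      field
        label  : ∀ {x} → x ∈ X → ∃[ i' ] ∃[ j' ] i < i' × Below (p ++ i' ∷ j' ∷ []) x
        edge⊆  : ∀ {e} → e ∈ D → e ⊆ X
        root∈F : ∀ {e} → e ∈ F → r ∈ e
        F⊆     : ∀ {e} → e ∈ F → Cov e (r ∷ []) X
        rep    : RootRep (V H) E₀ es v (T.Zs D [] [] X) (T.Zs (D ++ F) (r ∷ []) [] X)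

    crown : ∀ i es → drop i (filter (v ∈?_) (E H)) ≡ es → let ns = labelled (enumFrom (suc i) es) in
      Crown i es (concatMap V (subtrees ns)) (concatMap E (subtrees ns)) (rootEdges ns)
    crown i [] eq = record
      { label = λ () ; edge⊆ = λ () ; root∈F = λ () ; F⊆ = λ ()
      ; rep = RootRep-≈ (≈-sym G.Zs-[]) (≈-sym G.Zs-[]) (RootRep-empty E₀⊈) }
    crown i (e ∷ es) eq =
      ≡.subst₂ (λ X D → Crown i (e ∷ es) X D ((r ∷ b.rs) ∷ rootEdges ns))
        (≡.sym (concatMap-++ V (map (subtree (suc i) os) (enum os)) (subtrees ns)))
        (≡.sym (concatMap-++ E (map (subtree (suc i) os) (enum os)) (subtrees ns)))
        record
      { label  = λ x∈ → [ (λ x∈b → let j' , _ , bel = b.label x∈b in suc i , j' , ≤-refl , bel) ,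
                          (λ x∈c → let i' , j' , i<i' , bel = c.label x∈c in
                            i' , j' , ≤-trans (n≤1+n _) i<i' , bel)
                        ]′ (∈-++⁻ b.X x∈)
      ; edge⊆  = λ e∈ x∈ → [ (λ e∈b → ∈-++⁺ˡ (b.edge⊆ e∈b x∈)) , (λ e∈c → ∈-++⁺ʳ b.X (c.edge⊆ e∈c x∈)) ]′
                           (∈-++⁻ b.D e∈)
      ; root∈F = λ { (here refl) → here refl ; (there p) → c.root∈F p }
      ; F⊆     = λ { (here refl) → λ x∈ → Sum.map₂ ∈-++⁺ˡ (cov-b x∈)
                   ; (there p) x∈ → Sum.map₂ (∈-++⁺ʳ b.X) (c.F⊆ p x∈) }
      ; rep    = RootRep-≈
          (≈-sym (G.Zs-disjoint-++ {K₁ = []} {K₂ = []} (id , id)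
                    (λ e∈ x∈ → inj₂ (b.edge⊆ e∈ x∈)) (λ e∈ x∈ → inj₂ (c.edge⊆ e∈ x∈))
                    b#c (λ ()) (λ ())))
          -- On the tree side, the difference produced by `RootRep-step` is the branch of `e` with
          -- its root edge attached.
          (≈-trans (*-congʳ (G.Zs-addEdge b.edge⊆ r∉b b.root⊆))
            (≈-sym (G.Zs-disjoint-++ {E₁ = (r ∷ b.rs) ∷ b.D} {K₁ = []} {K₂ = []} regroup
                      (λ { (here refl) → cov-b ; (there e∈) x∈ → inj₂ (b.edge⊆ e∈ x∈) })
                      cov-c b#c (λ ()) (λ ()))))
          (RootRep-step E₀⊈ e~ (Rep-resp edges~ b.rep) c.rep)
      }
      where
      os = others e
      ns = labelled (enumFrom (suc (suc i)) es)
      next = drop-∷ i (filter (v ∈?_) (E H)) eq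
      e∈ : e ∈ E H × v ∈ e
      e∈ = ∈-filter⁻ (v ∈?_) {xs = E H} (drop-∷-∈ i (filter (v ∈?_) (E H)) eq)
      os⁻ : ∀ {x} → x ∈ os → x ∈ e × x ≢ v
      os⁻ = ∈-filter⁻ (λ u → ¬? (u ≟ v)) {xs = e}
      e~ : SameSet e (v ∷ os)
      e~ = to , λ { (here refl) → proj₂ e∈ ; (there q) → proj₁ (os⁻ q) }
        where
        to : e ⊆ v ∷ os
        to {x} x∈ with x ≟ v
        ... | yes refl = here refl
        ... | no x≢v   = there (∈-filter⁺ (λ u → ¬? (u ≟ v)) x∈ x≢v)
      b : Branch (suc i) os 0 os (enum os)
      b = ≡.subst (Branch (suc i) os 0 os) (≡.sym (enum≡enumFrom os))
            (branch (suc i) os (Unique.filter⁺ _ (Good.E-unique g (proj₁ e∈)))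
              (λ q → Good.E-⊆V g (proj₁ e∈) (proj₁ (os⁻ q))) (λ q → proj₂ (os⁻ q) refl) 0 os refl)
      module b = Branch b
      c = crown (suc i) es (proj₂ next)
      module c = Crown c
      cX = concatMap V (subtrees ns)
      cD = concatMap E (subtrees ns)
      -- The subtrees of `e`, which is hyperedge number `suc i`, live where `e` itself is deleted
      -- too, so exactly `es` remains at `v`.
      edges~ : SameSet (removeFirst (suc i) v (E H)) (es ++ E₀)
      edges~ = ≡.subst (λ l → SameSet (removeFirst (suc i) v (E H)) (l ++ E₀)) (proj₂ next)
                 (removeFirst-sameSet (suc i) v (E H))
      r∉b : r ∉ b.X
      r∉b q = let j , _ , bel = b.label q in root-not-below {p} {suc i} {j} {v} bel
      b#c : Disjoint b.X cX
      b#c {x} (x∈b , x∈c) =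
        let j , _ , bel = b.label x∈b
            i' , j' , i<i' , bel' = c.label x∈c
        in <⇒≢ i<i' (proj₁ (below-branch {p} {suc i} {j} {i'} {j'} {x} bel bel'))
      cov-b : Cov (r ∷ b.rs) (r ∷ []) b.X
      cov-b (here refl) = inj₁ (here refl)
      cov-b (there q)   = inj₂ (b.root⊆ q)
      cov-c : ∀ {f} → f ∈ cD ++ rootEdges ns → Cov f (r ∷ []) cX
      cov-c f∈ with ∈-++⁻ cD f∈
      ... | inj₁ q = inj₂ ∘ c.edge⊆ q
      ... | inj₂ q = c.F⊆ q
      regroup : SameSet ((b.D ++ cD) ++ (r ∷ b.rs) ∷ rootEdges ns) (((r ∷ b.rs) ∷ b.D) ++ cD ++ rootEdges ns)
      regroup = to , from
        where
        to : (b.D ++ cD) ++ (r ∷ b.rs) ∷ rootEdges ns ⊆ ((r ∷ b.rs) ∷ b.D) ++ cD ++ rootEdges ns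
        to q with ∈-++⁻ (b.D ++ cD) q
        ... | inj₂ (here q) = here q
        ... | inj₂ (there q) = there (∈-++⁺ʳ b.D (∈-++⁺ʳ cD q))
        ... | inj₁ q with ∈-++⁻ b.D q
        ...   | inj₁ q = there (∈-++⁺ˡ q)
        ...   | inj₂ q = there (∈-++⁺ʳ b.D (∈-++⁺ˡ q))
        from : ((r ∷ b.rs) ∷ b.D) ++ cD ++ rootEdges ns ⊆ (b.D ++ cD) ++ (r ∷ b.rs) ∷ rootEdges ns
        from (here q) = ∈-++⁺ʳ (b.D ++ cD) (here q)
        from (there q) with ∈-++⁻ b.D q
        ... | inj₁ q = ∈-++⁺ˡ (∈-++⁺ˡ q)
        ... | inj₂ q with ∈-++⁻ cD q
        ...   | inj₁ q = ∈-++⁺ˡ (∈-++⁺ʳ b.D q)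
        ...   | inj₂ q = ∈-++⁺ʳ (b.D ++ cD) (there q)

    represents : let ns = labelled (enum (filter (v ∈?_) (E H))) in
      Represents p v (hg (r ∷ concatMap V (subtrees ns)) (concatMap E (subtrees ns) ++ rootEdges ns)) H
    represents = record
      { below = λ { (here refl) → [] , ≡.sym (++-identityʳ p)
                  ; (there x∈) → let i' , j' , _ , q , eq = c.label x∈ in
                      i' ∷ j' ∷ q , ≡.trans eq (++-assoc p (i' ∷ j' ∷ []) q) }
      ; edge⊆ = edge
      ; root∈ = here refl
      ; rep = Rep-≈ (≈-sym (G.Zs-root r∉ c.root∈F)) (≈-sym (G.Zs-root-in r∉ c.root∈F))
          (RootRep⇒Rep v∈V (removeFirst-sameSet 0 v (E H)) (Good.E-nonempty g)
            (λ e∈ → proj₂ (∈-filter⁻ (v ∈?_) {xs = E H} e∈))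
            (λ e∈ → proj₂ (∈-filter⁻ (λ e → ¬? (v ∈? e)) {xs = E H} e∈)) c.rep)
      }
      where
      es = filter (v ∈?_) (E H)
      ns = labelled (enum es)
      X = concatMap V (subtrees ns)
      D = concatMap E (subtrees ns)
      c : Crown 0 es X D (rootEdges ns)
      c = ≡.subst (λ l → Crown 0 es (concatMap V (subtrees (labelled l)))
                           (concatMap E (subtrees (labelled l)))
                           (rootEdges (labelled l)))
            (≡.sym (enum≡enumFrom es)) (crown 0 es refl)
      module c = Crown c
      r∉ : r ∉ X
      r∉ q = let i , j , _ , bel = c.label q in root-not-below {p} {i} {j} {v} bel
      edge : ∀ {e} → e ∈ D ++ rootEdges ns → e ⊆ r ∷ X
      edge e∈ x∈ with ∈-++⁻ D e∈
      ... | inj₁ q = there (c.edge⊆ q x∈)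
      ... | inj₂ q = [ (λ { (here refl) → here refl }) , there ]′ (c.F⊆ q x∈)

  build-represents : ∀ k p H v → Good H → v ∈ V H → Represents p v (build k p H v) H
  build-represents zero    p H v g v∈V = lift-represents p H v g v∈V
  build-represents (suc k) p H v g v∈V with dec H
  ... | yes _ = lift-represents p H v g v∈V
  ... | no _  = Step.represents k p H v g v∈V (build-represents k)

-- The equality of ratios is cross-multiplied to make sense in any commutative ring. With variables
-- as weights both out-parts have constant term 1, from the empty set, so over a polynomial ring
-- this is the equality of rational functions.
theorem2p6 : {A : Set} (_≟_ : DecidableEquality A)
    (dec : (H : Hypergraph A) → Dec (IsLinearHypertree H))
    (R : CommutativeRing 0ℓ 0ℓ)
    (H : Hypergraph A) (n Δ b : ℕ) (v : A) →
    WellFormed H →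
    length (V H) ≡ n →
    (∀ {u} → u ∈ V H → Ops.degree _≟_ H u ≤ Δ) →
    All (λ e → length e ≤ suc b) (E H) →
    v ∈ V H →
    (w : A → CommutativeRing.Carrier R) →
    CommutativeRing._≈_ R
    (CommutativeRing._*_ R
    (Partition.Zin R _≟_ H v w)
    (Partition.Zout R (Weitz._≟T_ _≟_ dec) (Weitz.tree _≟_ dec H v) (Weitz.root _≟_ dec v) (λ u → w (Weitz.π _≟_ dec u))))
    (CommutativeRing._*_ R
    (Partition.Zin R (Weitz._≟T_ _≟_ dec) (Weitz.tree _≟_ dec H v) (Weitz.root _≟_ dec v) (λ u → w (Weitz.π _≟_ dec u)))
    (Partition.Zout R _≟_ H v w))
theorem2p6 {A} _≟_ dec R H n Δ b v wf _ _ _ v∈V w = begin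
  Partition.Zin R _≟_ H v w * Partition.Zout R _≟T_ T' r w'
    ≈⟨ *-cong (S.Zin≈Zs H v) (+-cong (T.Z≈Zs T') (-‿cong (T.Zin≈Zs T' r))) ⟩
  S.Zs (E H) [] (v ∷ []) (V H) * (T.Zs (E T') [] [] (V T') - T.Zs (E T') [] (r ∷ []) (V T'))
    ≈⟨ Multiples.Rep-total R _≟_ w (Good.V-unique g) (Good.E-nonempty g) rep ⟩
  T.Zs (E T') [] (r ∷ []) (V T') * (S.Zs (E H) [] [] (V H) - S.Zs (E H) [] (v ∷ []) (V H))
    ≈⟨ *-cong (T.Zin≈Zs T' r) (+-cong (S.Z≈Zs H) (-‿cong (S.Zin≈Zs H v))) ⟨
  Partition.Zin R _≟T_ T' r w' * Partition.Zout R _≟_ H v w ∎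
  where
  open CommutativeRing R using (_*_; _+_; _-_; *-cong; +-cong; -‿cong; setoid)
  open import Relation.Binary.Reasoning.Setoid setoid
  open WeitzTree R _≟_ dec w
  open Weitz _≟_ dec
  open Residuals _≟_
  T' = tree H v
  r = root v
  w' : TVertex A → CommutativeRing.Carrier R
  w' u = w (π u)
  g = wellFormed⇒good wf
  open Represents (build-represents (suc (length (E H))) [] H v g v∈V)
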